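{- Let $\lambda$ be a partition, and let $\mathcal{S}(\lambda)$ denote the set of all plane overpartitions of shape $\lambda$. Then $$\sum_{\Pi \in \mathcal{S}(\lambda)} a^{o(\Pi)}q^{|\Pi|}=q^{\sum_i i\lambda_i}\prod_{(i,j)\in\lambda}\frac{1+aq^{c_{i,j}}}{1-q^{h_{i,j}}}.$$
   Context: A partition $\lambda=(\lambda_1\ge\lambda_2\ge\dots\ge\lambda_\ell>0)$ is identified with its Ferrers diagram, the set of cells $(i,j)$ with $1\le i\le \ell$, $1\le j\le\lambda_i$; $\lambda'$ is the conjugate partition. For a cell $(i,j)$, the hook length is $h_{i,j}=\lambda_i+\lambda'_j-i-j+1$ and the content is $c_{i,j}=j-i$. A plane overpartition of shape $\lambda$ is a filling of the cells of $\lambda$ with positive integers, weakly decreasing along each row (left to right) and each column (top to bottom), in which some entries are overlined subject to: (1) in each row, only the last (rightmost) occurrence of a given integer may be overlined, all other occurrences of that integer in the row being non-overlined; (2) in each column, the first (topmost) occurrence of a given integer may be overlined or not, and all other occurrences of that integer in the column are overlined. For a plane overpartition $\Pi$, $|\Pi|$ is the sum of all entries (ignoring overlines) and $o(\Pi)$ is the number of overlined entries. The identity is of formal power series in $q$ with coefficients polynomials in $a$. -}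

module Defs where

open import Data.Nat using (ℕ; zero; suc; _+_; _*_; _∸_; _≤_; _<_; _≥_; _≟_; _≤?_)
open import Data.Nat.Divisibility using (_∣?_)
open import Data.Bool using (Bool; true; false; if_then_else_; _∧_)
open import Data.List using (List; []; _∷_; map; length; filter; upTo; _++_; foldr; concat)
open import Data.Nat.ListAction using (sum)
open import Data.List.Relation.Unary.All using (All)
open import Data.List.Relation.Unary.Linked using (Linked)
open import Data.Maybe using (Maybe; just; nothing)
open import Data.Product using (_×_; _,_; proj₁; proj₂)
open import Relation.Binary.PropositionalEquality using (_≡_; _≢_)
open import Relation.Nullary.Decidable using (⌊_⌋)

IsPartition : List ℕ → Set
IsPartition sh = Linked _≥_ sh × All (λ r → 1 ≤ r) sh

-- Fillings: a list of rows; each entry is (value , overlined?).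

Entry : Set
Entry = ℕ × Bool

Filling : Set
Filling = List (List Entry)

nth : {A : Set} → List A → ℕ → Maybe A
nth []       _       = nothing
nth (x ∷ xs) zero    = just x
nth (x ∷ xs) (suc i) = nth xs i

at : Filling → ℕ → ℕ → Maybe Entry
at F i j with nth F i
... | nothing = nothing
... | just row = nth row j

record IsPlaneOverpartition (sh : List ℕ) (F : Filling) : Set where
  field
    shape    : map length F ≡ sh
    positive : ∀ i j v b → at F i j ≡ just (v , b) → 1 ≤ v
    -- rows weakly decreasing; an overlined entry is the last occurrence
    -- of its value in the row (the next entry, if any, is strictly smaller)
    rowCond  : ∀ i j v b v' b' → at F i j ≡ just (v , b) → at F i (suc j) ≡ just (v' , b') →
               (v' ≤ v) × (b ≡ true → v' < v)
    -- columns weakly decreasing; every occurrence of a value in a column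
    -- other than the topmost one is overlined
    colCond  : ∀ i j v b v' b' → at F i j ≡ just (v , b) → at F (suc i) j ≡ just (v' , b') →
               (v' ≤ v) × (v' ≡ v → b' ≡ true)

size : Filling → ℕ
size F = sum (map (λ row → sum (map proj₁ row)) F)

overlines : Filling → ℕ
overlines F = sum (map (λ row → length (filter (λ e → proj₂ e Data.Bool.≟ true) row)) F)

-- Formal power series in q with coefficients polynomials in a (here with
-- ℕ coefficients, which suffices since all series involved are ℕ-valued):
-- s n k = coefficient of q^n a^k.

Series : Set
Series = ℕ → ℕ → ℕ

ind : Bool → ℕ
ind true  = 1
ind false = 0

sumTo : ℕ → (ℕ → ℕ) → ℕ
sumTo zero    f = f zero
sumTo (suc n) f = sumTo n f + f (suc n)

oneS : Series
oneS n k = ind (⌊ n ≟ 0 ⌋ ∧ ⌊ k ≟ 0 ⌋)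

_*S_ : Series → Series → Series
(f *S g) n k = sumTo n (λ n₁ → sumTo k (λ k₁ → f n₁ k₁ * g (n ∸ n₁) (k ∸ k₁)))

prodS : List Series → Series
prodS = foldr _*S_ oneS

-- the monomial q^i + a q^j   (= q^i (1 + a q^(j - i)))
binom : ℕ → ℕ → Series
binom i j n k = ind (⌊ n ≟ i ⌋ ∧ ⌊ k ≟ 0 ⌋) + ind (⌊ n ≟ j ⌋ ∧ ⌊ k ≟ 1 ⌋)

-- 1 / (1 - q^h) = Σ_{m ≥ 0} q^{h m}
geom : ℕ → Series
geom h n k = ind (⌊ h ∣? n ⌋ ∧ ⌊ k ≟ 0 ⌋)

-- Cells, hooks (1-indexed as in the paper).

cellsFrom : ℕ → List ℕ → List (ℕ × ℕ)
cellsFrom i []       = []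
cellsFrom i (r ∷ rs) = map (λ j → (i , j)) (map suc (upTo r)) ++ cellsFrom (suc i) rs

cells : List ℕ → List (ℕ × ℕ)
cells = cellsFrom 1

-- λ_i (1-indexed), 0 outside
row : List ℕ → ℕ → ℕ
row []       _             = 0
row (r ∷ rs) zero          = 0
row (r ∷ rs) (suc zero)    = r
row (r ∷ rs) (suc (suc i)) = row rs (suc i)

conj : List ℕ → ℕ → ℕ
conj sh j = length (filter (λ r → j ≤? r) sh)

hook : List ℕ → ℕ → ℕ → ℕ
hook sh i j = (row sh i + conj sh j + 1) ∸ (i + j)

-- content c_{i,j} = j - i appears via q^i (1 + a q^{j-i}) = q^i + a q^j.

-- q^{Σ i λ_i} ∏_{(i,j) ∈ λ} (1 + a q^{c_{i,j}}) / (1 - q^{h_{i,j}})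
--   = ∏_{(i,j) ∈ λ} (q^i + a q^j) / (1 - q^{h_{i,j}})
rhs : List ℕ → Series
rhs sh = prodS (map (λ c → binom (proj₁ c) (proj₂ c) *S geom (hook sh (proj₁ c) (proj₂ c))) (cells sh))

{-# OPTIONS --safe #-}
module Submission where

-- Plane overpartitions of shape λ are peeled by value: the entries 1̄ form a
-- vertical strip, after which the entries 1 form a horizontal strip. With
-- hᵘₙ = ∏_{j ≤ n} (u + a q^j) / (1 - q^j) and Dᵘ(λ) = det (hᵘ_{λᵢ - i + j}), the
-- identities h^q_n = q^n (h¹_n + a h¹_{n-1}) and h¹_n = h^q_n + h¹_{n-1} turn, by
-- multilinearity and the vanishing of determinants with two equal rows, into
-- D^q(λ) = q^|λ| Σ a^|λ/ν| D¹(ν) over vertical strips λ/ν and D¹(ν) = Σ D^q(μ)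
-- over horizontal strips ν/μ. The counting series satisfies the same recursion,
-- so it is D^q. Column operations that clear the first row give
-- Dᵘ(λ₁, λ₂, …) = ∏_{j ≤ λ₁} (u + a q^j) / (1 - q^{h_{1,j}}) · D^{qu}(λ₂, …),
-- which iterates to the product formula.

open import Defs
open import Data.Nat using (ℕ)
open import Data.List using (List; length)
open import Data.List.Membership.Propositional using (_∈_)
open import Data.List.Relation.Unary.Unique.Propositional using (Unique)
open import Data.Product using (Σ; _×_)
open import Relation.Binary.PropositionalEquality using (_≡_)

open import Algebra using (CommutativeRing)
import Algebra.Construct.Pointwise as Pointwise
import Algebra.Properties.Ring as RingProperties
import Algebra.Properties.Semiring.Exp as Exp
import Algebra.Solver.Ring.NaturalCoefficients.Default as NaturalCoefficients
open import Data.Bool using (Bool; true; false; _∧_)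
import Data.Bool as Bool
import Data.Bool.Properties as Boolₚ
open import Data.Empty using (⊥-elim)
open import Data.Integer using (ℤ; +_)
import Data.Integer as ℤ
import Data.Integer.Properties as ℤₚ
open import Data.List using ([]; _∷_; map; concatMap; filter; replicate; upTo; downFrom; _++_)
open import Data.List.Membership.Propositional.Properties using (∈-++⁺ˡ; ∈-++⁺ʳ; ∈-++⁻; ∈-map⁺; ∈-map⁻)
open import Data.List.Properties
  using (++-assoc; filter-accept; filter-reject; length-++; length-map; length-replicate; map-++; upTo-∷ʳ)
open import Data.List.Relation.Unary.All using (All; []; _∷_)
import Data.List.Relation.Unary.All as All
import Data.List.Relation.Unary.All.Properties as Allₚ
open import Data.List.Relation.Unary.AllPairs using ([]; _∷_)
open import Data.List.Relation.Unary.Any using (here; there)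
open import Data.List.Relation.Unary.Linked using (Linked; []; [-]; _∷_)
import Data.List.Relation.Unary.Unique.Propositional.Properties as Uniqueₚ
open import Data.Maybe using (Maybe; just; nothing; maybe′)
open import Data.Nat using (zero; suc; _∸_; _≤_; _<_; _≥_; z≤n; s≤s; _≤?_; _≟_)
import Data.Nat as ℕ
open import Data.Nat.Divisibility using (_∣?_; ∣m+n∣m⇒∣n; ∣m∣n⇒∣m+n; ∣-refl; ∣⇒≤)
open import Data.Nat.Induction using (<-rec)
open import Data.Nat.ListAction using (sum)
import Data.Nat.Properties as ℕₚ
open import Data.Nat.Solver using (module +-*-Solver)
open import Data.Product using (_,_; proj₁; proj₂)
open import Data.Sum using (_⊎_; inj₁; inj₂)
open import Data.Unit using (⊤; tt)
open import Relation.Binary.PropositionalEquality using (cong; cong₂)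
import Relation.Binary.PropositionalEquality as ≡
import Relation.Binary.Reasoning.Setoid as SetoidReasoning
open import Relation.Nullary using (Dec; yes; no; ¬_)
open import Relation.Nullary.Decidable using (⌊_⌋; isYes≗does; dec-true; dec-false)

-- The obstacle is that hook products do not visibly satisfy the strip recursion. Determinants can
-- be expanded one row at a time, and the expansions that leave the class of partitions are the
-- degenerate ones. The price is signs, so the counting series are embedded in power series over the
-- integers, and an enumeration compares the length of its list with an integer coefficient.
--
-- The parameter u alternates between q and 1 because two alphabets alternate. Once the entries 1̄
-- are gone and all values are lowered by one, 0 occurs only without an overline; once these zeros
-- are gone, all entries are positive again. Lowering every cell produces q^|λ| and strictly reduces
-- the degree in q, so the recursion determines every coefficient. General powers u = q^i enter only
-- in the evaluation, one for each row of cells.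
--
-- Parts that become zero are kept, so the matrices do not change size along the recursion. Division
-- is avoided where possible: q is only cancelled, and 1 - q^k is inverted by a geometric series.

-- Determinants over a commutative ring, by signed sums over picks from a list

module Determinants {c ℓ} (R : CommutativeRing c ℓ) where
  open CommutativeRing R
  open RingProperties ring using (-‿distribʳ-*; -‿+-comm; -0#≈0#)
  open NaturalCoefficients commutativeSemiring using (solve; _:=_; _:+_; _:*_)
  open SetoidReasoning setoid

  -- f receives the picked element and the list of the other ones.
  alt : ∀ {b} {B : Set b} → (B → List B → Carrier) → List B → Carrier
  alt f []       = 0#
  alt f (b ∷ bs) = f b bs - alt (λ c cs → f c (b ∷ cs)) bs

  -- Laplace expansion along the first row. Rows and columns are lists of labels, so that a minor
  -- arises by deleting labels; lists of different lengths give 0.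
  det : ∀ {a b} {A : Set a} {B : Set b} → (A → B → Carrier) → List A → List B → Carrier
  det e []       []      = 1#
  det e []       (_ ∷ _) = 0#
  det e (a ∷ as) bs      = alt (λ b bs′ → e a b * det e as bs′) bs

  Σ[_] : ∀ {x} {X : Set x} → List X → (X → Carrier) → Carrier
  Σ[ []     ] f = 0#
  Σ[ x ∷ xs ] f = f x + Σ[ xs ] f

  Π[_] : ∀ {x} {X : Set x} → List X → (X → Carrier) → Carrier
  Π[ []     ] f = 1#
  Π[ x ∷ xs ] f = f x * Π[ xs ] f

  x-y≈0 : ∀ {x y} → x ≈ y → x - y ≈ 0#
  x-y≈0 {x} {y} x≈y = trans (+-congʳ x≈y) (-‿inverseʳ y)

  +-interchange : ∀ w x y z → (w + x) + (y + z) ≈ (w + y) + (x + z)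
  +-interchange = solve 4 (λ w x y z → (w :+ x) :+ (y :+ z) := (w :+ y) :+ (x :+ z)) refl

  *-interchange : ∀ w x y z → (w * x) * (y * z) ≈ (w * y) * (x * z)
  *-interchange = solve 4 (λ w x y z → (w :* x) :* (y :* z) := (w :* y) :* (x :* z)) refl

  *-swapˡ : ∀ x y z → x * (y * z) ≈ y * (x * z)
  *-swapˡ = solve 3 (λ x y z → x :* (y :* z) := y :* (x :* z)) refl

  *-distribˡ-- : ∀ x y z → x * (y - z) ≈ x * y - x * z
  *-distribˡ-- x y z = trans (distribˡ x y (- z)) (+-congˡ (sym (-‿distribʳ-* x z)))

  Σ-cong : ∀ {x} {X : Set x} (xs : List X) {f g : X → Carrier} →
           (∀ x → f x ≈ g x) → Σ[ xs ] f ≈ Σ[ xs ] g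
  Σ-cong []       f≈g = refl
  Σ-cong (x ∷ xs) f≈g = +-cong (f≈g x) (Σ-cong xs f≈g)

  Σ-++ : ∀ {x} {X : Set x} (xs ys : List X) f → Σ[ xs ++ ys ] f ≈ Σ[ xs ] f + Σ[ ys ] f
  Σ-++ []       ys f = sym (+-identityˡ _)
  Σ-++ (x ∷ xs) ys f = trans (+-congˡ (Σ-++ xs ys f)) (sym (+-assoc _ _ _))

  Σ-concatMap : ∀ {x y} {X : Set x} {Y : Set y} (g : X → List Y) (xs : List X) f →
                Σ[ concatMap g xs ] f ≈ Σ[ xs ] (λ x → Σ[ g x ] f)
  Σ-concatMap g []       f = refl
  Σ-concatMap g (x ∷ xs) f = trans (Σ-++ (g x) _ f) (+-congˡ (Σ-concatMap g xs f))

  Σ-map : ∀ {x y} {X : Set x} {Y : Set y} (g : X → Y) (xs : List X) f →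
          Σ[ map g xs ] f ≈ Σ[ xs ] (λ x → f (g x))
  Σ-map g []       f = refl
  Σ-map g (x ∷ xs) f = +-congˡ (Σ-map g xs f)

  Σ-*ˡ : ∀ {x} {X : Set x} (xs : List X) k f → Σ[ xs ] (λ x → k * f x) ≈ k * Σ[ xs ] f
  Σ-*ˡ []       k f = sym (zeroʳ k)
  Σ-*ˡ (x ∷ xs) k f = trans (+-congˡ (Σ-*ˡ xs k f)) (sym (distribˡ k _ _))

  Π-cong : ∀ {x} {X : Set x} (xs : List X) {f g : X → Carrier} →
           (∀ x → f x ≈ g x) → Π[ xs ] f ≈ Π[ xs ] g
  Π-cong []       f≈g = refl
  Π-cong (x ∷ xs) f≈g = *-cong (f≈g x) (Π-cong xs f≈g)

  Π-++ : ∀ {x} {X : Set x} (xs ys : List X) f → Π[ xs ++ ys ] f ≈ Π[ xs ] f * Π[ ys ] f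
  Π-++ []       ys f = sym (*-identityˡ _)
  Π-++ (x ∷ xs) ys f = trans (*-congˡ (Π-++ xs ys f)) (sym (*-assoc _ _ _))

  Π-map : ∀ {x y} {X : Set x} {Y : Set y} (g : X → Y) (xs : List X) f →
          Π[ map g xs ] f ≈ Π[ xs ] (λ x → f (g x))
  Π-map g []       f = refl
  Π-map g (x ∷ xs) f = *-congˡ (Π-map g xs f)

  alt-cong : ∀ {b} {B : Set b} {f g : B → List B → Carrier} (bs : List B) →
             (∀ b bs → f b bs ≈ g b bs) → alt f bs ≈ alt g bs
  alt-cong []       f≈g = refl
  alt-cong (b ∷ bs) f≈g = +-cong (f≈g b bs) (-‿cong (alt-cong bs (λ c cs → f≈g c (b ∷ cs))))

  alt-0 : ∀ {b} {B : Set b} (bs : List B) → alt (λ _ _ → 0#) bs ≈ 0#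
  alt-0 []       = refl
  alt-0 (b ∷ bs) = x-y≈0 (sym (alt-0 bs))

  alt-+ : ∀ {b} {B : Set b} (f g : B → List B → Carrier) (bs : List B) →
          alt (λ b bs → f b bs + g b bs) bs ≈ alt f bs + alt g bs
  alt-+ f g []       = sym (+-identityˡ 0#)
  alt-+ f g (b ∷ bs) =
    trans (+-congˡ (trans (-‿cong (alt-+ (λ c cs → f c (b ∷ cs)) (λ c cs → g c (b ∷ cs)) bs))
                          (sym (-‿+-comm _ _))))
          (+-interchange _ _ _ _)

  alt-*ˡ : ∀ {b} {B : Set b} (k : Carrier) (f : B → List B → Carrier) (bs : List B) →
           alt (λ b bs → k * f b bs) bs ≈ k * alt f bs
  alt-*ˡ k f []       = sym (zeroʳ k)
  alt-*ˡ k f (b ∷ bs) =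
    trans (+-congˡ (-‿cong (alt-*ˡ k (λ c cs → f c (b ∷ cs)) bs))) (sym (*-distribˡ-- k _ _))

  alt-neg : ∀ {b} {B : Set b} (f : B → List B → Carrier) (bs : List B) →
           alt (λ b bs → - f b bs) bs ≈ - alt f bs
  alt-neg f []       = sym -0#≈0#
  alt-neg f (b ∷ bs) =
    trans (+-congˡ (-‿cong (alt-neg (λ c cs → f c (b ∷ cs)) bs))) (-‿+-comm _ _)

  alt-Σ : ∀ {b x} {B : Set b} {X : Set x} (f : X → B → List B → Carrier) (xs : List X) (bs : List B) →
          alt (λ b bs → Σ[ xs ] (λ x → f x b bs)) bs ≈ Σ[ xs ] (λ x → alt (f x) bs)
  alt-Σ f []       bs = alt-0 bs
  alt-Σ f (x ∷ xs) bs = trans (alt-+ (f x) _ bs) (+-congˡ (alt-Σ f xs bs))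

  alt-swap : ∀ {a b} {A : Set a} {B : Set b} (f : A → List A → B → List B → Carrier)
             (as : List A) (bs : List B) →
             alt (λ a as → alt (f a as) bs) as ≈ alt (λ b bs → alt (λ a as → f a as b bs) as) bs
  alt-swap f []       bs = sym (alt-0 bs)
  alt-swap f (a ∷ as) bs = begin
    alt (f a as) bs - alt (λ c cs → alt (f c (a ∷ cs)) bs) as
      ≈⟨ +-congˡ (-‿cong (alt-swap (λ c cs → f c (a ∷ cs)) as bs)) ⟩
    alt (f a as) bs - alt (λ b bs → alt (λ c cs → f c (a ∷ cs) b bs) as) bs
      ≈⟨ +-congˡ (alt-neg _ bs) ⟨
    alt (f a as) bs + alt (λ b bs → - alt (λ c cs → f c (a ∷ cs) b bs) as) bs
      ≈⟨ alt-+ _ _ bs ⟨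
    alt (λ b bs → alt (λ a as → f a as b bs) (a ∷ as)) bs ∎

  -- The ordered picks b, c and c, b leave the same list but carry opposite signs. In the induction
  -- step the pairs containing the head cancel directly, and the pairs within the tail vanish by
  -- induction.
  alt-symmetric : ∀ {b} {B : Set b} (f : B → B → List B → Carrier) →
                  (∀ b c cs → f b c cs ≈ f c b cs) → (bs : List B) →
                  alt (λ b bs → alt (f b) bs) bs ≈ 0#
  alt-symmetric f sy []       = refl
  alt-symmetric f sy (b ∷ bs) = x-y≈0 (begin
    alt (f b) bs
      ≈⟨ alt-cong bs (λ c cs → sy b c cs) ⟩
    alt (λ c cs → f c b cs) bs
      ≈⟨ +-identityʳ _ ⟨
    alt (λ c cs → f c b cs) bs + 0#
      ≈⟨ +-congˡ (trans (-‿cong (alt-symmetric (λ c d ds → f c d (b ∷ ds)) (λ c d ds → sy c d (b ∷ ds)) bs)) -0#≈0#) ⟨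
    alt (λ c cs → f c b cs) bs - alt (λ c cs → alt (λ d ds → f c d (b ∷ ds)) cs) bs
      ≈⟨ +-congˡ (alt-neg _ bs) ⟨
    alt (λ c cs → f c b cs) bs + alt (λ c cs → - alt (λ d ds → f c d (b ∷ ds)) cs) bs
      ≈⟨ alt-+ _ _ bs ⟨
    alt (λ c cs → alt (f c) (b ∷ cs)) bs ∎)

  det-cong : ∀ {a b} {A : Set a} {B : Set b} {e e′ : A → B → Carrier} (as : List A) (bs : List B) →
             (∀ a b → e a b ≈ e′ a b) → det e as bs ≈ det e′ as bs
  det-cong []       []      e≈e′ = refl
  det-cong []       (_ ∷ _) e≈e′ = refl
  det-cong (a ∷ as) bs      e≈e′ = alt-cong bs (λ b bs′ → *-cong (e≈e′ a b) (det-cong as bs′ e≈e′))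

  -- Expanding along the first row leaves minors that still contain the column `b`; induction
  -- expands these, and `alt-swap` interchanges the two signed sums. Invariance under transposition
  -- follows.
  det-column : ∀ {a b} {A : Set a} {B : Set b} (e : A → B → Carrier) as b bs →
               det e as (b ∷ bs) ≈ alt (λ a as′ → e a b * det e as′ bs) as
  det-column e []       b bs = refl
  det-column e (a ∷ as) b bs = +-congˡ (-‿cong (begin
    alt (λ c cs → e a c * det e as (b ∷ cs)) bs
      ≈⟨ alt-cong bs (λ c cs → *-congˡ (det-column e as b cs)) ⟩
    alt (λ c cs → e a c * alt (λ a′ as′ → e a′ b * det e as′ cs) as) bs
      ≈⟨ alt-cong bs (λ c cs → trans (sym (alt-*ˡ _ _ as)) (alt-cong as (λ a′ as′ → *-swapˡ _ _ _))) ⟩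
    alt (λ c cs → alt (λ a′ as′ → e a′ b * (e a c * det e as′ cs)) as) bs
      ≈⟨ alt-swap (λ a′ as′ c cs → e a′ b * (e a c * det e as′ cs)) as bs ⟨
    alt (λ a′ as′ → alt (λ c cs → e a′ b * (e a c * det e as′ cs)) bs) as
      ≈⟨ alt-cong as (λ a′ as′ → alt-*ˡ _ _ bs) ⟩
    alt (λ a′ as′ → e a′ b * det e (a ∷ as′) bs) as ∎))

  det-transpose : ∀ {a b} {A : Set a} {B : Set b} (e : A → B → Carrier) as bs →
                  det e as bs ≈ det (λ b a → e a b) bs as
  det-transpose e []       []       = refl
  det-transpose e (a ∷ as) []       = refl
  det-transpose e as       (b ∷ bs) =
    trans (det-column e as b bs) (alt-cong as (λ a as′ → *-congˡ (det-transpose e as′ bs)))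

  det-repeated : ∀ {a b} {A : Set a} {B : Set b} (e : A → B → Carrier) a as bs →
                 det e (a ∷ a ∷ as) bs ≈ 0#
  det-repeated e a as bs = trans
    (alt-cong bs (λ b bs′ → sym (alt-*ˡ _ _ bs′)))
    (alt-symmetric (λ b c cs → e a b * (e a c * det e as cs)) (λ b c cs → *-swapˡ _ _ _) bs)

  det-scale : ∀ {a b} {A : Set a} {B : Set b} (ρ : A → Carrier) (e : A → B → Carrier) as bs →
              det (λ a b → ρ a * e a b) as bs ≈ Π[ as ] ρ * det e as bs
  det-scale ρ e []       []      = sym (*-identityˡ _)
  det-scale ρ e []       (_ ∷ _) = sym (*-identityˡ _)
  det-scale ρ e (a ∷ as) bs      = trans
    (alt-cong bs (λ b bs′ → trans (*-congˡ (det-scale ρ e as bs′)) (*-interchange _ _ _ _)))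
    (alt-*ˡ _ _ bs)

  det-scaleᵀ : ∀ {a b} {A : Set a} {B : Set b} (κ : B → Carrier) (e : A → B → Carrier) as bs →
               det (λ a b → κ b * e a b) as bs ≈ Π[ bs ] κ * det e as bs
  det-scaleᵀ κ e as bs = begin
    det (λ a b → κ b * e a b) as bs  ≈⟨ det-transpose _ as bs ⟩
    det (λ b a → κ b * e a b) bs as  ≈⟨ det-scale κ _ bs as ⟩
    Π[ bs ] κ * det (λ b a → e a b) bs as ≈⟨ *-congˡ (det-transpose e as bs) ⟨
    Π[ bs ] κ * det e as bs ∎

-- Partitions, vertical and horizontal strips, and their enumeration

head₀ : List ℕ → ℕ
head₀ []      = 0
head₀ (x ∷ _) = x

-- Partitions with a fixed number of parts, zero parts being allowed.
Part : List ℕ → Set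
Part []       = ⊤
Part (x ∷ xs) = head₀ xs ≤ x × Part xs

-- λᵢ ↦ λᵢ + (r - i), where r is the number of parts.
shift : List ℕ → List ℕ
shift []       = []
shift (x ∷ xs) = (x ℕ.+ length xs) ∷ shift xs

defect : List ℕ → List ℕ → ℕ
defect (x ∷ xs) (y ∷ ys) = (x ∸ y) ℕ.+ defect xs ys
defect _        _        = 0

data VStrip : List ℕ → List ℕ → Set where
  []   : VStrip [] []
  keep : ∀ {x xs ys} → head₀ ys ≤ x → VStrip xs ys → VStrip (x ∷ xs) (x ∷ ys)
  drop : ∀ {x xs ys} → head₀ ys ≤ x → VStrip xs ys → VStrip (suc x ∷ xs) (x ∷ ys)

data HStrip : List ℕ → List ℕ → Set where
  []   : HStrip [] []
  cons : ∀ {x y xs ys} → head₀ xs ≤ y → y ≤ x → HStrip xs ys → HStrip (x ∷ xs) (y ∷ ys)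

-- Built from the bottom part upwards, because the values open to a part depend on what lies below:
-- on the outer `xs` for horizontal strips, on the chosen `ys` for vertical ones.
strips : (ℕ → List ℕ → List ℕ → List ℕ) → List ℕ → List (List ℕ)
strips choices []       = [] ∷ []
strips choices (x ∷ xs) = concatMap (λ ys → map (_∷ ys) (choices x xs ys)) (strips choices xs)

-- The order is descending to match the telescoping in `det-horizontal`, which splits off the
-- largest index first.
interval : ℕ → ℕ → List ℕ
interval y zero    = y ∷ []
interval y (suc d) = suc (y ℕ.+ d) ∷ interval y d

vChoices : ℕ → List ℕ → List ℕ → List ℕ
vChoices zero    xs ys = zero ∷ []
vChoices (suc x) xs ys with head₀ ys ≤? x
... | yes _ = suc x ∷ x ∷ []
... | no  _ = suc x ∷ []

hChoices : ℕ → List ℕ → List ℕ → List ℕ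
hChoices x xs ys = interval (head₀ xs) (x ∸ head₀ xs)

vStrips hStrips : List ℕ → List (List ℕ)
vStrips = strips vChoices
hStrips = strips hChoices

interval⁻ : ∀ y d {z} → z ∈ interval y d → y ≤ z × z ≤ y ℕ.+ d
interval⁻ y zero    (here ≡.refl) = ℕₚ.≤-refl , ℕₚ.m≤m+n y 0
interval⁻ y (suc d) (here ≡.refl) =
  ℕₚ.≤-trans (ℕₚ.m≤m+n y d) (ℕₚ.n≤1+n _) , ℕₚ.≤-reflexive (≡.sym (ℕₚ.+-suc y d))
interval⁻ y (suc d) (there z∈)    =
  let y≤z , z≤ = interval⁻ y d z∈ in y≤z , ℕₚ.≤-trans z≤ (ℕₚ.+-monoʳ-≤ y (ℕₚ.n≤1+n d))

interval⁺ : ∀ y d {z} → y ≤ z → z ≤ y ℕ.+ d → z ∈ interval y d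
interval⁺ y zero    y≤z z≤ = here (ℕₚ.≤-antisym (≡.subst (_ ≤_) (ℕₚ.+-identityʳ y) z≤) y≤z)
interval⁺ y (suc d) {z} y≤z z≤ with z ≤? y ℕ.+ d
... | yes z≤y+d = there (interval⁺ y d y≤z z≤y+d)
... | no  z≰y+d = here (ℕₚ.≤-antisym (≡.subst (z ≤_) (ℕₚ.+-suc y d) z≤) (ℕₚ.≰⇒> z≰y+d))

∈-strips⁻ : ∀ choices x xs {zs} → zs ∈ strips choices (x ∷ xs) →
            Σ (List ℕ) λ ys → Σ ℕ λ y → ys ∈ strips choices xs × y ∈ choices x xs ys × zs ≡ y ∷ ys
∈-strips⁻ choices x xs zs∈ = go (strips choices xs) zs∈
  where
  go : ∀ yss {zs} → zs ∈ concatMap (λ ys → map (_∷ ys) (choices x xs ys)) yss →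
       Σ (List ℕ) λ ys → Σ ℕ λ y → ys ∈ yss × y ∈ choices x xs ys × zs ≡ y ∷ ys
  go (ys ∷ yss) zs∈ with ∈-++⁻ (map (_∷ ys) (choices x xs ys)) zs∈
  ... | inj₁ p = let y , y∈ , eq = ∈-map⁻ (_∷ ys) p in ys , y , here ≡.refl , y∈ , eq
  ... | inj₂ p = let ys′ , y , ys∈ , rest = go yss p in ys′ , y , there ys∈ , rest

∈-strips⁺ : ∀ choices x xs {y ys} → ys ∈ strips choices xs → y ∈ choices x xs ys →
            y ∷ ys ∈ strips choices (x ∷ xs)
∈-strips⁺ choices x xs ys∈ y∈ = go (strips choices xs) ys∈ y∈
  where
  go : ∀ yss {y ys} → ys ∈ yss → y ∈ choices x xs ys →
       y ∷ ys ∈ concatMap (λ ys → map (_∷ ys) (choices x xs ys)) yss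
  go (ys ∷ yss) (here ≡.refl) y∈ = ∈-++⁺ˡ (∈-map⁺ (_∷ ys) y∈)
  go (ys ∷ yss) (there ys∈)   y∈ = ∈-++⁺ʳ (map (_∷ ys) (choices x xs ys)) (go yss ys∈ y∈)

VStrip-head : ∀ {xs ys} → VStrip xs ys → head₀ ys ≤ head₀ xs
VStrip-head []         = z≤n
VStrip-head (keep _ _) = ℕₚ.≤-refl
VStrip-head (drop _ _) = ℕₚ.n≤1+n _

VStrip-length : ∀ {xs ys} → VStrip xs ys → length ys ≡ length xs
VStrip-length []         = ≡.refl
VStrip-length (keep _ p) = cong suc (VStrip-length p)
VStrip-length (drop _ p) = cong suc (VStrip-length p)

VStrip-Part : ∀ {xs ys} → VStrip xs ys → Part ys
VStrip-Part []         = tt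
VStrip-Part (keep h p) = h , VStrip-Part p
VStrip-Part (drop h p) = h , VStrip-Part p

HStrip-head : ∀ {xs ys} → HStrip xs ys → head₀ ys ≤ head₀ xs
HStrip-head []           = z≤n
HStrip-head (cons _ l _) = l

HStrip-length : ∀ {xs ys} → HStrip xs ys → length ys ≡ length xs
HStrip-length []           = ≡.refl
HStrip-length (cons _ _ p) = cong suc (HStrip-length p)

HStrip-Part : ∀ {xs ys} → HStrip xs ys → Part ys
HStrip-Part []           = tt
HStrip-Part (cons h _ p) = ℕₚ.≤-trans (HStrip-head p) h , HStrip-Part p

∈-vStrips⁻ : ∀ xs → Part xs → ∀ {ys} → ys ∈ vStrips xs → VStrip xs ys
∈-vStrips⁻ []       _        (here ≡.refl) = []
∈-vStrips⁻ (x ∷ xs) (h , pt) ys∈ with ∈-strips⁻ vChoices x xs ys∈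
... | ys , y , ys∈′ , y∈ , ≡.refl = choose x h y∈
  where
  p : VStrip xs ys
  p = ∈-vStrips⁻ xs pt ys∈′
  choose : ∀ x → head₀ xs ≤ x → ∀ {y} → y ∈ vChoices x xs ys → VStrip (x ∷ xs) (y ∷ ys)
  choose zero    h (here ≡.refl) = keep (ℕₚ.≤-trans (VStrip-head p) h) p
  choose (suc x) h y∈ with head₀ ys ≤? x | y∈
  ... | yes ys≤x | here ≡.refl         = keep (ℕₚ.m≤n⇒m≤1+n ys≤x) p
  ... | yes ys≤x | there (here ≡.refl) = drop ys≤x p
  ... | no  _    | here ≡.refl         = keep (ℕₚ.≤-trans (VStrip-head p) h) p

∈-vStrips⁺ : ∀ {xs ys} → VStrip xs ys → ys ∈ vStrips xs
∈-vStrips⁺ [] = here ≡.refl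
∈-vStrips⁺ {x ∷ xs} {_ ∷ ys} (keep _ p) = ∈-strips⁺ vChoices x xs (∈-vStrips⁺ p) (choose x)
  where
  choose : ∀ x → x ∈ vChoices x xs ys
  choose zero    = here ≡.refl
  choose (suc x) with head₀ ys ≤? x
  ... | yes _ = here ≡.refl
  ... | no  _ = here ≡.refl
∈-vStrips⁺ {suc x ∷ xs} {_ ∷ ys} (drop h p) = ∈-strips⁺ vChoices (suc x) xs (∈-vStrips⁺ p) choose
  where
  choose : x ∈ vChoices (suc x) xs ys
  choose with head₀ ys ≤? x
  ... | yes _ = there (here ≡.refl)
  ... | no  ¬h = ⊥-elim (¬h h)

∈-hStrips⁻ : ∀ xs → Part xs → ∀ {ys} → ys ∈ hStrips xs → HStrip xs ys
∈-hStrips⁻ []       _        (here ≡.refl) = []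
∈-hStrips⁻ (x ∷ xs) (h , pt) ys∈ with ∈-strips⁻ hChoices x xs ys∈
... | ys , y , ys∈′ , y∈ , ≡.refl =
  let h≤y , y≤ = interval⁻ (head₀ xs) _ y∈
  in cons h≤y (≡.subst (y ≤_) (ℕₚ.m+[n∸m]≡n h) y≤) (∈-hStrips⁻ xs pt ys∈′)

∈-hStrips⁺ : ∀ {xs ys} → HStrip xs ys → ys ∈ hStrips xs
∈-hStrips⁺ [] = here ≡.refl
∈-hStrips⁺ {x ∷ xs} (cons h l p) = ∈-strips⁺ hChoices x xs (∈-hStrips⁺ p)
  (interval⁺ (head₀ xs) _ h (≡.subst (_ ≤_) (≡.sym (ℕₚ.m+[n∸m]≡n (ℕₚ.≤-trans h l))) l))

-- Expansion of determinants over strips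

module DeterminantStrips {c ℓ} (R : CommutativeRing c ℓ) where
  open CommutativeRing R hiding (zero)
  open Determinants R
  open Exp semiring using (_^_; ^-homo-*)
  open NaturalCoefficients commutativeSemiring using (solve; _:=_; _:+_; _:*_)
  open SetoidReasoning setoid

  Σ-cong-∈ : ∀ {x} {X : Set x} (xs : List X) {f g : X → Carrier} →
             (∀ {x} → x ∈ xs → f x ≈ g x) → Σ[ xs ] f ≈ Σ[ xs ] g
  Σ-cong-∈ []       f≈g = refl
  Σ-cong-∈ (x ∷ xs) f≈g = +-cong (f≈g (here ≡.refl)) (Σ-cong-∈ xs (λ x∈ → f≈g (there x∈)))

  Σ-strips : ∀ choices x xs f → Σ[ strips choices (x ∷ xs) ] f ≈
             Σ[ strips choices xs ] (λ ys → Σ[ choices x xs ys ] (λ y → f (y ∷ ys)))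
  Σ-strips choices x xs f = trans (Σ-concatMap _ (strips choices xs) f)
    (Σ-cong (strips choices xs) (λ ys → Σ-map (_∷ ys) (choices x xs ys) f))

  module _ {b} {B : Set b} where

    pre : (ℕ → B → Carrier) → ℕ → B → Carrier
    pre e zero    b = 0#
    pre e (suc l) b = e l b

    row-det : (B → Carrier) → (ℕ → B → Carrier) → List ℕ → List B → Carrier
    row-det f e ls = alt (λ b bs → f b * det e ls bs)

    row-det-cong : ∀ {f g} e ls bs → (∀ b → f b ≈ g b) → row-det f e ls bs ≈ row-det g e ls bs
    row-det-cong e ls bs f≈g = alt-cong bs (λ b bs → *-congʳ (f≈g b))

    row-det-+ : ∀ f g e ls bs →
      row-det (λ b → f b + g b) e ls bs ≈ row-det f e ls bs + row-det g e ls bs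
    row-det-+ f g e ls bs = trans (alt-cong bs (λ b bs → distribʳ _ _ _)) (alt-+ _ _ bs)

    row-det-*ˡ : ∀ k f e ls bs → row-det (λ b → k * f b) e ls bs ≈ k * row-det f e ls bs
    row-det-*ˡ k f e ls bs = trans (alt-cong bs (λ b bs → *-assoc _ _ _)) (alt-*ˡ k _ bs)

    -- Lowering the index by one gives exactly the first label of `shift xs`, so two adjacent rows
    -- coincide. For empty `xs` the index is 0 and `pre` supplies a zero row.
    row-det-pre : ∀ e xs bs → row-det (pre e (head₀ xs ℕ.+ length xs)) e (shift xs) bs ≈ 0#
    row-det-pre e []       bs = trans (alt-cong bs (λ _ _ → zeroˡ _)) (alt-0 bs)
    row-det-pre e (x ∷ xs) bs rewrite ℕₚ.+-suc x (length xs) = det-repeated e _ (shift xs) bs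

    det-[] : ∀ (e e′ : ℕ → B → Carrier) bs → det e [] bs ≈ det e′ [] bs
    det-[] e e′ []      = refl
    det-[] e e′ (_ ∷ _) = refl

    row-det-Σ : ∀ {x} {X : Set x} (is : List X) (f : X → B → Carrier) e ls bs →
      row-det (λ b → Σ[ is ] (λ i → f i b)) e ls bs ≈ Σ[ is ] (λ i → row-det (f i) e ls bs)
    row-det-Σ is f e ls bs = trans
      (alt-cong bs (λ b bs → trans (*-comm _ _) (trans (sym (Σ-*ˡ is _ (λ i → f i b))) (Σ-cong is (λ i → *-comm _ _)))))
      (alt-Σ _ is bs)

    -- The recursion telescopes the top row into the rows `e (y + n)` with `head₀ xs ≤ y ≤ x`, plus
    -- a remainder equal to the second row. The remainder is a row of `k`, so it must be discarded
    -- before the lower rows are expanded in terms of `e`.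
    det-horizontal : ∀ k e → (∀ l b → k l b ≈ e l b + pre k l b) → ∀ xs → Part xs → ∀ bs →
      det k (shift xs) bs ≈ Σ[ hStrips xs ] (λ ys → det e (shift ys) bs)
    det-horizontal k e k≈ []       _        bs = trans (det-[] _ _ bs) (sym (+-identityʳ _))
    det-horizontal k e k≈ (x ∷ xs) (h , pt) bs = begin
      row-det (k (x ℕ.+ n)) k (shift xs) bs
        ≈⟨ row-det-cong k (shift xs) bs (λ b → sym (telescope b)) ⟩
      row-det (λ b → sumRow b + pre k (head₀ xs ℕ.+ n) b) k (shift xs) bs
        ≈⟨ trans (row-det-+ _ _ k (shift xs) bs) (trans (+-congˡ (row-det-pre k xs bs)) (+-identityʳ _)) ⟩
      row-det sumRow k (shift xs) bs
        ≈⟨ alt-cong bs (λ b bs → trans (*-congˡ (det-horizontal k e k≈ xs pt bs)) (sym (Σ-*ˡ (hStrips xs) _ _))) ⟩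
      alt (λ b bs → Σ[ hStrips xs ] (λ ys → sumRow b * det e (shift ys) bs)) bs
        ≈⟨ alt-Σ _ (hStrips xs) bs ⟩
      Σ[ hStrips xs ] (λ ys → row-det sumRow e (shift ys) bs)
        ≈⟨ Σ-cong-∈ (hStrips xs) (λ {ys} ys∈ → trans (row-det-Σ rowRange (λ y → e (y ℕ.+ n)) e (shift ys) bs)
             (Σ-cong rowRange (λ y → reflexive (cong (λ n → row-det (e (y ℕ.+ n)) e (shift ys) bs)
               (≡.sym (HStrip-length (∈-hStrips⁻ xs pt ys∈))))))) ⟩
      Σ[ hStrips xs ] (λ ys → Σ[ rowRange ] (λ y → det e (shift (y ∷ ys)) bs))
        ≈⟨ Σ-strips hChoices x xs _ ⟨
      Σ[ hStrips (x ∷ xs) ] (λ zs → det e (shift zs) bs) ∎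
      where
      n : ℕ
      n = length xs
      rowRange : List ℕ
      rowRange = interval (head₀ xs) (x ∸ head₀ xs)
      sumRow : B → Carrier
      sumRow b = Σ[ rowRange ] (λ y → e (y ℕ.+ n) b)
      partial : ∀ y d b → Σ[ interval y d ] (λ y → e (y ℕ.+ n) b) + pre k (y ℕ.+ n) b ≈ k ((y ℕ.+ d) ℕ.+ n) b
      partial y zero    b rewrite ℕₚ.+-identityʳ y =
        trans (+-congʳ (+-identityʳ _)) (sym (k≈ (y ℕ.+ n) b))
      partial y (suc d) b rewrite ℕₚ.+-suc y d =
        trans (+-assoc _ _ _) (trans (+-congˡ (partial y d b)) (sym (k≈ _ b)))
      telescope : ∀ b → sumRow b + pre k (head₀ xs ℕ.+ n) b ≈ k (x ℕ.+ n) b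
      telescope b = trans (partial (head₀ xs) (x ∸ head₀ xs) b)
        (reflexive (cong (λ l → k (l ℕ.+ n) b) (ℕₚ.m+[n∸m]≡n h)))

    -- Here the lower rows are expanded first: whether lowering the top index repeats a row depends
    -- on the first part of the chosen `ys`. The repetition occurs exactly when `vChoices` offers no
    -- second value.
    det-vertical : ∀ a e xs → Part xs → ∀ bs →
      det (λ l b → e l b + a * pre e l b) (shift xs) bs ≈
      Σ[ vStrips xs ] (λ ys → a ^ defect xs ys * det e (shift ys) bs)
    det-vertical a e []       _        bs =
      trans (det-[] _ _ bs) (sym (trans (+-identityʳ _) (*-identityˡ _)))
    det-vertical a e (x ∷ xs) (h , pt) bs = begin
      alt (λ b bs → E (x ℕ.+ length xs) b * det E (shift xs) bs) bs
        ≈⟨ alt-cong bs (λ b bs → trans (*-congˡ (det-vertical a e xs pt bs)) (sym (Σ-*ˡ (vStrips xs) _ _))) ⟩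
      alt (λ b bs → Σ[ vStrips xs ] (λ ys → E (x ℕ.+ length xs) b * (w ys * det e (shift ys) bs))) bs
        ≈⟨ alt-Σ _ (vStrips xs) bs ⟩
      Σ[ vStrips xs ] (λ ys → alt (λ b bs → E (x ℕ.+ length xs) b * (w ys * det e (shift ys) bs)) bs)
        ≈⟨ Σ-cong-∈ (vStrips xs) (λ {ys} ys∈ → choose ys (∈-vStrips⁻ xs pt ys∈)) ⟩
      Σ[ vStrips xs ] (λ ys → Σ[ vChoices x xs ys ] (λ y →
        a ^ (x ∸ y ℕ.+ defect xs ys) * det e (shift (y ∷ ys)) bs))
        ≈⟨ Σ-strips vChoices x xs _ ⟨
      Σ[ vStrips (x ∷ xs) ] (λ zs → a ^ defect (x ∷ xs) zs * det e (shift zs) bs) ∎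
      where
      E : ℕ → B → Carrier
      E l b = e l b + a * pre e l b
      w : List ℕ → Carrier
      w ys = a ^ defect xs ys
      split : ∀ ys l → alt (λ b bs → E l b * (w ys * det e (shift ys) bs)) bs ≈
              w ys * row-det (e l) e (shift ys) bs + a * w ys * row-det (pre e l) e (shift ys) bs
      split ys l = begin
        alt (λ b bs → E l b * (w ys * det e (shift ys) bs)) bs
          ≈⟨ trans (alt-cong bs (λ b bs → *-swapˡ _ _ _)) (alt-*ˡ _ _ bs) ⟩
        w ys * row-det (E l) e (shift ys) bs
          ≈⟨ *-congˡ (trans (row-det-+ _ _ e (shift ys) bs) (+-congˡ (row-det-*ˡ a _ e (shift ys) bs))) ⟩
        w ys * (row-det (e l) e (shift ys) bs + a * row-det (pre e l) e (shift ys) bs)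
          ≈⟨ solve 4 (λ w x a y → w :* (x :+ a :* y) := w :* x :+ a :* w :* y) refl _ _ _ _ ⟩
        w ys * row-det (e l) e (shift ys) bs + a * w ys * row-det (pre e l) e (shift ys) bs ∎
      choose : ∀ ys → VStrip xs ys →
        alt (λ b bs → E (x ℕ.+ length xs) b * (w ys * det e (shift ys) bs)) bs ≈
        Σ[ vChoices x xs ys ] (λ y → a ^ (x ∸ y ℕ.+ defect xs ys) * det e (shift (y ∷ ys)) bs)
      choose ys p rewrite ≡.sym (VStrip-length p) = trans (split ys (x ℕ.+ length ys)) (go x (ℕₚ.≤-trans (VStrip-head p) h))
        where
        kept : ∀ x → head₀ ys ≡ x →
          w ys * row-det (e (x ℕ.+ length ys)) e (shift ys) bs +
          a * w ys * row-det (pre e (x ℕ.+ length ys)) e (shift ys) bs ≈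
          a ^ (x ∸ x ℕ.+ defect xs ys) * det e (shift (x ∷ ys)) bs + 0#
        kept x ≡.refl rewrite ℕₚ.n∸n≡0 x = +-congˡ (trans (*-congˡ (row-det-pre e ys bs)) (zeroʳ _))
        go : ∀ x → head₀ ys ≤ x →
          w ys * row-det (e (x ℕ.+ length ys)) e (shift ys) bs +
          a * w ys * row-det (pre e (x ℕ.+ length ys)) e (shift ys) bs ≈
          Σ[ vChoices x xs ys ] (λ y → a ^ (x ∸ y ℕ.+ defect xs ys) * det e (shift (y ∷ ys)) bs)
        go zero    ys≤0 = kept zero (ℕₚ.n≤0⇒n≡0 ys≤0)
        go (suc x) ys≤1+x with head₀ ys ≤? x
        ... | no  ys≰x = kept (suc x) (ℕₚ.≤-antisym ys≤1+x (ℕₚ.≰⇒> ys≰x))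
        ... | yes ys≤x rewrite ℕₚ.n∸n≡0 x | ℕₚ.m+n∸n≡m 1 x = +-congˡ (sym (+-identityʳ _))

-- Conjugate partitions and products over ranges of hook lengths

conj-accept : ∀ s ss {j} → j ≤ s → conj (s ∷ ss) j ≡ suc (conj ss j)
conj-accept s ss {j} j≤s = cong length (filter-accept (j ≤?_) j≤s)

conj-0 : ∀ ss → Part ss → ∀ {j} → head₀ ss < j → conj ss j ≡ 0
conj-0 []       _        _   = ≡.refl
conj-0 (s ∷ ss) (h , pt) {j} s<j =
  ≡.trans (cong length (filter-reject (j ≤?_) (ℕₚ.<⇒≱ s<j))) (conj-0 ss pt (ℕₚ.≤-<-trans h s<j))

module RangeProducts {c ℓ} (R : CommutativeRing c ℓ) where
  open CommutativeRing R hiding (zero)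
  open Determinants R
  open NaturalCoefficients commutativeSemiring using (solve; _:=_; _:+_; _:*_)
  open SetoidReasoning setoid

  Π₁ : (ℕ → Carrier) → ℕ → Carrier
  Π₁ f zero    = 1#
  Π₁ f (suc n) = f (suc n) * Π₁ f n

  Π₁-cong : ∀ {f g} n → (∀ i → 1 ≤ i → i ≤ n → f i ≈ g i) → Π₁ f n ≈ Π₁ g n
  Π₁-cong zero    f≈g = refl
  Π₁-cong (suc n) f≈g = *-cong (f≈g (suc n) (s≤s z≤n) ℕₚ.≤-refl)
    (Π₁-cong n (λ i 1≤i i≤n → f≈g i 1≤i (ℕₚ.m≤n⇒m≤1+n i≤n)))

  Π₁-* : ∀ f g n → Π₁ (λ i → f i * g i) n ≈ Π₁ f n * Π₁ g n
  Π₁-* f g zero    = sym (*-identityˡ 1#)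
  Π₁-* f g (suc n) = trans (*-congˡ (Π₁-* f g n)) (*-interchange _ _ _ _)

  Π₁-+ : ∀ f m n → Π₁ f (m ℕ.+ n) ≈ Π₁ f m * Π₁ (λ i → f (m ℕ.+ i)) n
  Π₁-+ f m zero    rewrite ℕₚ.+-identityʳ m = sym (*-identityʳ _)
  Π₁-+ f m (suc n) rewrite ℕₚ.+-suc m n = trans (*-congˡ (Π₁-+ f m n)) (*-swapˡ _ _ _)

  Π₁-reverse : ∀ f n → Π₁ (λ i → f (suc (n ∸ i))) n ≈ Π₁ f n
  Π₁-reverse f zero    = refl
  Π₁-reverse f (suc n) = begin
    f (suc (n ∸ n)) * Π₁ (λ i → f (suc (suc n ∸ i))) n
      ≈⟨ *-cong (reflexive (cong (λ k → f (suc k)) (ℕₚ.n∸n≡0 n)))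
           (Π₁-cong n (λ i _ i≤n → reflexive (cong (λ k → f (suc k)) (ℕₚ.+-∸-assoc 1 i≤n)))) ⟩
    f 1 * Π₁ (λ i → f (suc (suc (n ∸ i)))) n
      ≈⟨ *-congˡ (Π₁-reverse (λ i → f (suc i)) n) ⟩
    f 1 * Π₁ (λ i → f (suc i)) n
      ≈⟨ *-congʳ (*-identityʳ _) ⟨
    Π₁ f 1 * Π₁ (λ i → f (suc i)) n
      ≈⟨ Π₁-+ f 1 n ⟨
    Π₁ f (suc n) ∎

  Π-downFrom : ∀ f m n → Π₁ f (m ℕ.+ n) ≈ Π₁ f m * Π[ downFrom n ] (λ c → f (m ℕ.+ n ∸ c))
  Π-downFrom f m zero    rewrite ℕₚ.+-identityʳ m = sym (*-identityʳ _)
  Π-downFrom f m (suc n) rewrite ℕₚ.+-suc m n | ℕₚ.m+n∸n≡m (suc m) n =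
    trans (Π-downFrom f (suc m) n) (trans (*-congʳ (*-comm _ _)) (*-assoc _ _ _))

  Π-upTo : ∀ f n → Π[ map suc (upTo n) ] f ≈ Π₁ f n
  Π-upTo f zero    = refl
  Π-upTo f (suc n) = begin
    Π[ map suc (upTo (suc n)) ] f
      ≈⟨ reflexive (cong (λ is → Π[ is ] f)
           (≡.trans (cong (map suc) (≡.sym (upTo-∷ʳ n))) (map-++ suc (upTo n) (n ∷ [])))) ⟩
    Π[ map suc (upTo n) ++ suc n ∷ [] ] f
      ≈⟨ Π-++ (map suc (upTo n)) (suc n ∷ []) f ⟩
    Π[ map suc (upTo n) ] f * (f (suc n) * 1#)
      ≈⟨ *-cong (Π-upTo f n) (*-identityʳ _) ⟩
    Π₁ f n * f (suc n)
      ≈⟨ *-comm _ _ ⟩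
    Π₁ f (suc n) ∎

  -- The hook lengths of the first row together with the differences l₁ - lₖ
  -- fill {1, …, l₁}; the offset d makes the induction on the lower rows go through.
  hooks-complement : ∀ g d e rs → Part rs →
    Π₁ (λ j → g (suc (d ℕ.+ ((head₀ rs ℕ.+ e) ∸ j ℕ.+ conj rs j)))) (head₀ rs ℕ.+ e) *
      Π[ shift rs ] (λ l → g (d ℕ.+ (head₀ rs ℕ.+ e ℕ.+ length rs) ∸ l)) ≈
    Π₁ (λ t → g (d ℕ.+ t)) (head₀ rs ℕ.+ e ℕ.+ length rs)
  hooks-complement g d e [] _ rewrite ℕₚ.+-identityʳ e = begin
    Π₁ (λ j → g (suc (d ℕ.+ (e ∸ j ℕ.+ 0)))) e * 1#
      ≈⟨ *-identityʳ _ ⟩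
    Π₁ (λ j → g (suc (d ℕ.+ (e ∸ j ℕ.+ 0)))) e
      ≈⟨ Π₁-cong e (λ j _ _ → reflexive (cong g (≡.trans (cong (λ k → suc (d ℕ.+ k)) (ℕₚ.+-identityʳ _))
           (≡.sym (ℕₚ.+-suc d _))))) ⟩
    Π₁ (λ j → g (d ℕ.+ suc (e ∸ j))) e
      ≈⟨ Π₁-reverse (λ t → g (d ℕ.+ t)) e ⟩
    Π₁ (λ t → g (d ℕ.+ t)) e ∎
  hooks-complement g d e (s ∷ ss) (h , pt) = begin
    Π₁ hk (s ℕ.+ e) * (G (s ℕ.+ length ss) * Π[ shift ss ] G)
      ≈⟨ *-cong (trans (Π₁-+ hk s e) (*-cong (Π₁-cong s inner) (trans (Π₁-cong e outer) (Π₁-reverse _ e))))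
           (*-cong (reflexive (cong g corner)) (Π-cong (shift ss) (λ l → reflexive (cong (λ k → g (k ∸ l)) total)))) ⟩
    (Π₁ hk′ s * Π₁ (λ t → g (d ℕ.+ t)) e) * (g (d ℕ.+ suc e) * Π[ shift ss ] (λ l → g (d′ ℕ.+ (s ℕ.+ length ss) ∸ l)))
      ≈⟨ solve 4 (λ x y z w → (x :* y) :* (z :* w) := (z :* y) :* (x :* w)) refl _ _ _ _ ⟩
    Π₁ (λ t → g (d ℕ.+ t)) (suc e) * (Π₁ hk′ s * Π[ shift ss ] (λ l → g (d′ ℕ.+ (s ℕ.+ length ss) ∸ l)))
      ≈⟨ *-congˡ IH ⟩
    Π₁ (λ t → g (d ℕ.+ t)) (suc e) * Π₁ (λ t → g (d′ ℕ.+ t)) (s ℕ.+ length ss)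
      ≈⟨ *-congˡ (Π₁-cong (s ℕ.+ length ss) (λ t _ _ → reflexive (cong g (ℕₚ.+-assoc d (suc e) t)))) ⟩
    Π₁ (λ t → g (d ℕ.+ t)) (suc e) * Π₁ (λ t → g (d ℕ.+ (suc e ℕ.+ t))) (s ℕ.+ length ss)
      ≈⟨ Π₁-+ (λ t → g (d ℕ.+ t)) (suc e) (s ℕ.+ length ss) ⟨
    Π₁ (λ t → g (d ℕ.+ t)) (suc e ℕ.+ (s ℕ.+ length ss))
      ≈⟨ reflexive (cong (Π₁ (λ t → g (d ℕ.+ t))) (NS.solve 3 (λ e s n → NS.con 1 NS.:+ e NS.:+ (s NS.:+ n) NS.:= s NS.:+ e NS.:+ (NS.con 1 NS.:+ n)) ≡.refl e s (length ss))) ⟩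
    Π₁ (λ t → g (d ℕ.+ t)) (s ℕ.+ e ℕ.+ suc (length ss)) ∎
    where
    module NS = +-*-Solver
    d′ : ℕ
    d′ = d ℕ.+ suc e
    hk hk′ G : ℕ → Carrier
    hk j = g (suc (d ℕ.+ ((s ℕ.+ e) ∸ j ℕ.+ conj (s ∷ ss) j)))
    hk′ j = g (suc (d′ ℕ.+ (s ∸ j ℕ.+ conj ss j)))
    G l = g (d ℕ.+ (s ℕ.+ e ℕ.+ suc (length ss)) ∸ l)
    inner : ∀ j → 1 ≤ j → j ≤ s → hk j ≈ hk′ j
    inner j _ j≤s = reflexive (cong (λ k → g (suc k)) (≡.trans
      (cong₂ (λ u v → d ℕ.+ (u ℕ.+ v)) (≡.trans (cong (_∸ j) (ℕₚ.+-comm s e)) (ℕₚ.+-∸-assoc e j≤s)) (conj-accept s ss j≤s))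
      (NS.solve 4 (λ d e x y → d NS.:+ (e NS.:+ x NS.:+ (NS.con 1 NS.:+ y)) NS.:= d NS.:+ (NS.con 1 NS.:+ e) NS.:+ (x NS.:+ y))
        ≡.refl d e (s ∸ j) (conj ss j))))
    outer : ∀ i → 1 ≤ i → i ≤ e → hk (s ℕ.+ i) ≈ g (d ℕ.+ suc (e ∸ i))
    outer i 1≤i _ = reflexive (cong g (≡.trans
      (cong₂ (λ u v → suc (d ℕ.+ (u ℕ.+ v))) (ℕₚ.[m+n]∸[m+o]≡n∸o s e i)
        (conj-0 (s ∷ ss) (h , pt) (ℕₚ.≤-trans (ℕₚ.≤-reflexive (ℕₚ.+-comm 1 s)) (ℕₚ.+-monoʳ-≤ s 1≤i))))
      (NS.solve 2 (λ d x → NS.con 1 NS.:+ (d NS.:+ (x NS.:+ NS.con 0)) NS.:= d NS.:+ (NS.con 1 NS.:+ x)) ≡.refl d (e ∸ i))))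
    total : d ℕ.+ (s ℕ.+ e ℕ.+ suc (length ss)) ≡ d′ ℕ.+ (s ℕ.+ length ss)
    total = NS.solve 4 (λ d s e n → d NS.:+ (s NS.:+ e NS.:+ (NS.con 1 NS.:+ n)) NS.:= d NS.:+ (NS.con 1 NS.:+ e) NS.:+ (s NS.:+ n)) ≡.refl d s e (length ss)
    corner : d ℕ.+ (s ℕ.+ e ℕ.+ suc (length ss)) ∸ (s ℕ.+ length ss) ≡ d ℕ.+ suc e
    corner = ≡.trans (cong (_∸ (s ℕ.+ length ss)) total) (ℕₚ.m+n∸n≡m d′ (s ℕ.+ length ss))
    IH : Π₁ hk′ s * Π[ shift ss ] (λ l → g (d′ ℕ.+ (s ℕ.+ length ss) ∸ l)) ≈ Π₁ (λ t → g (d′ ℕ.+ t)) (s ℕ.+ length ss)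
    IH = ≡.subst (λ s → Π₁ (λ j → g (suc (d′ ℕ.+ (s ∸ j ℕ.+ conj ss j)))) s * Π[ shift ss ] (λ l → g (d′ ℕ.+ (s ℕ.+ length ss) ∸ l)) ≈ Π₁ (λ t → g (d′ ℕ.+ t)) (s ℕ.+ length ss))
      (ℕₚ.m+[n∸m]≡n h) (hooks-complement g d′ (s ∸ head₀ ss) ss pt)

-- Evaluation of the determinants as products over hooks and contents

module Evaluation {c ℓ} (R : CommutativeRing c ℓ) where
  open CommutativeRing R hiding (zero)
  open Determinants R
  open DeterminantStrips R
  open RangeProducts R
  open RingProperties ring using (-0#≈0#)
  open Exp semiring using (_^_; ^-homo-*)
  open NaturalCoefficients commutativeSemiring using (solve; _:=_; _:+_; _:*_; con)
  open SetoidReasoning setoid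

  -- Each `ẽ c` splits into a multiple of `e c` and a multiple of the row above it. Working
  -- downwards from the unmodified row `e n`, the row above has already been restored, so the second
  -- multiple repeats a row and only the factor `α c` remains.
  det-eliminate : ∀ {b} {B : Set b} (α β : ℕ → Carrier) (e ẽ : ℕ → B → Carrier) →
    (∀ c b → ẽ c b ≈ α c * e c b + β c * e (suc c) b) → ∀ n bs →
    row-det (e n) ẽ (downFrom n) bs ≈ Π[ downFrom n ] α * det e (downFrom (suc n)) bs
  det-eliminate α β e ẽ ẽ≈ zero    bs = trans
    (alt-cong bs (λ b bs → *-congˡ (det-[] ẽ e bs))) (sym (*-identityˡ _))
  det-eliminate α β e ẽ ẽ≈ (suc n) bs = begin
    alt (λ b bs → e (suc n) b * row-det (ẽ n) ẽ (downFrom n) bs) bs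
      ≈⟨ alt-cong bs (λ b bs → *-congˡ (expand bs)) ⟩
    alt (λ b bs → e (suc n) b * (P * det e (downFrom (suc n)) bs + β n * row-det (e (suc n)) ẽ (downFrom n) bs)) bs
      ≈⟨ alt-cong bs (λ b bs → solve 5 (λ x p d y z → x :* (p :* d :+ y :* z) := p :* (x :* d) :+ y :* (x :* z)) refl _ _ _ _ _) ⟩
    alt (λ b bs → P * (e (suc n) b * det e (downFrom (suc n)) bs) + β n * (e (suc n) b * row-det (e (suc n)) ẽ (downFrom n) bs)) bs
      ≈⟨ trans (alt-+ _ _ bs) (+-cong (alt-*ˡ _ _ bs) (alt-*ˡ _ _ bs)) ⟩
    P * det e (downFrom (suc (suc n))) bs + β n * alt (λ b bs → e (suc n) b * row-det (e (suc n)) ẽ (downFrom n) bs) bs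
      ≈⟨ +-congˡ (trans (*-congˡ repeated) (zeroʳ _)) ⟩
    P * det e (downFrom (suc (suc n))) bs + 0#
      ≈⟨ +-identityʳ _ ⟩
    P * det e (downFrom (suc (suc n))) bs ∎
    where
    P : Carrier
    P = Π[ downFrom (suc n) ] α
    expand : ∀ bs → row-det (ẽ n) ẽ (downFrom n) bs ≈
      P * det e (downFrom (suc n)) bs + β n * row-det (e (suc n)) ẽ (downFrom n) bs
    expand bs = begin
      row-det (ẽ n) ẽ (downFrom n) bs
        ≈⟨ row-det-cong ẽ (downFrom n) bs (ẽ≈ n) ⟩
      row-det (λ b → α n * e n b + β n * e (suc n) b) ẽ (downFrom n) bs
        ≈⟨ trans (row-det-+ _ _ ẽ (downFrom n) bs)
             (+-cong (row-det-*ˡ _ _ ẽ (downFrom n) bs) (row-det-*ˡ _ _ ẽ (downFrom n) bs)) ⟩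
      α n * row-det (e n) ẽ (downFrom n) bs + β n * row-det (e (suc n)) ẽ (downFrom n) bs
        ≈⟨ +-congʳ (trans (*-congˡ (det-eliminate α β e ẽ ẽ≈ n bs)) (sym (*-assoc _ _ _))) ⟩
      P * det e (downFrom (suc n)) bs + β n * row-det (e (suc n)) ẽ (downFrom n) bs ∎
    repeated : alt (λ b bs → e (suc n) b * row-det (e (suc n)) ẽ (downFrom n) bs) bs ≈ 0#
    repeated = trans
      (alt-cong bs (λ b bs′ → sym (alt-*ˡ _ _ bs′)))
      (alt-symmetric (λ b c cs → e (suc n) b * (e (suc n) c * det ẽ (downFrom n) cs)) (λ b c cs → *-swapˡ _ _ _) bs)

  -- The series `geo` enters only through `geo-unfold`, which makes it inverse to 1 - q^k for
  -- positive k, and q is only known to be cancellable.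
  module HookContent
    (q a : Carrier) (geo : ℕ → Carrier)
    (geo-unfold : ∀ h → geo (suc h) ≈ 1# + q ^ suc h * geo (suc h))
    (q-cancel : ∀ x y → q * x ≈ q * y → x ≈ y)
    where

    -- The one-row case of the product formula, with q^i generalized to u.
    H : Carrier → ℕ → Carrier
    H u zero    = 1#
    H u (suc n) = H u n * ((u + a * q ^ suc n) * geo (suc n))

    -- This is `f` at l - c, extended by zero to negative indices, where truncated subtraction would
    -- wrongly give `f 0`.
    entry : (ℕ → Carrier) → ℕ → ℕ → Carrier
    entry f l       zero    = f l
    entry f zero    (suc c) = 0#
    entry f (suc l) (suc c) = entry f l c

    -- The Jacobi-Trudi determinant: with r parts, the row label λᵢ + r - i and the column label r -
    -- j give the index λᵢ - i + j.
    JT : Carrier → List ℕ → Carrier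
    JT u xs = det (entry (H u)) (shift xs) (downFrom (length xs))

    -- Each of the n + 1 binomials releases one factor q, after which the exponents run from 0 to n
    -- in place of 1 to n + 1; the factor with exponent 0 is u + a.
    H-shift : ∀ u n → H (q * u) (suc n) ≈ q ^ suc n * (u + a) * (H u n * geo (suc n))
    H-shift u zero    = solve 4 (λ q u a g →
      con 1 :* ((q :* u :+ a :* (q :* con 1)) :* g) := (q :* con 1) :* (u :+ a) :* (con 1 :* g)) refl q u a (geo 1)
    H-shift u (suc n) = begin
      H (q * u) (suc n) * ((q * u + a * (q * q ^ suc n)) * geo (2 ℕ.+ n))
        ≈⟨ *-congʳ (H-shift u n) ⟩
      q ^ suc n * (u + a) * (H u n * geo (suc n)) * ((q * u + a * (q * q ^ suc n)) * geo (2 ℕ.+ n))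
        ≈⟨ solve 7 (λ q Q u a h g g′ → Q :* (u :+ a) :* (h :* g) :* ((q :* u :+ a :* (q :* Q)) :* g′) :=
             q :* Q :* (u :+ a) :* (h :* ((u :+ a :* Q) :* g) :* g′)) refl q (q ^ suc n) u a (H u n) (geo (suc n)) (geo (2 ℕ.+ n)) ⟩
      q ^ (2 ℕ.+ n) * (u + a) * (H u (suc n) * geo (2 ℕ.+ n)) ∎

    H-geo : ∀ u n → H u n * geo (suc n) ≈ H u n + q ^ suc n * (H u n * geo (suc n))
    H-geo u n = trans (*-congˡ (geo-unfold n))
      (solve 3 (λ h Q g → h :* (con 1 :+ Q :* g) := h :+ Q :* (h :* g)) refl _ _ _)

    -- Writing the parameter as `q * 1#` makes it an instance of `q * u`, and equal to `q ^ 1` by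
    -- definition, as the product formula requires for the first row.
    H-horizontal : ∀ n → H 1# (suc n) ≈ H (q * 1#) (suc n) + H 1# n
    H-horizontal n = begin
      H 1# n * ((1# + a * Q) * g)
        ≈⟨ solve 4 (λ h a Q g → h :* ((con 1 :+ a :* Q) :* g) := h :* g :+ a :* Q :* (h :* g)) refl _ _ _ _ ⟩
      H 1# n * g + a * Q * (H 1# n * g)
        ≈⟨ +-congʳ (H-geo 1# n) ⟩
      H 1# n + Q * (H 1# n * g) + a * Q * (H 1# n * g)
        ≈⟨ solve 4 (λ h a Q x → h :+ Q :* x :+ a :* Q :* x := Q :* (con 1 :+ a) :* x :+ h) refl _ _ _ _ ⟩
      Q * (1# + a) * (H 1# n * g) + H 1# n
        ≈⟨ +-congʳ (H-shift 1# n) ⟨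
      H (q * 1#) (suc n) + H 1# n ∎
      where
      Q = q ^ suc n
      g = geo (suc n)

    H-vertical : ∀ n → H (q * 1#) (suc n) ≈ q ^ suc n * (H 1# (suc n) + a * H 1# n)
    H-vertical n = begin
      H (q * 1#) (suc n)
        ≈⟨ H-shift 1# n ⟩
      Q * (1# + a) * (H 1# n * g)
        ≈⟨ solve 3 (λ a Q x → Q :* (con 1 :+ a) :* x := Q :* (x :+ a :* x)) refl _ _ _ ⟩
      Q * (H 1# n * g + a * (H 1# n * g))
        ≈⟨ *-congˡ (+-congˡ (*-congˡ (H-geo 1# n))) ⟩
      Q * (H 1# n * g + a * (H 1# n + Q * (H 1# n * g)))
        ≈⟨ solve 4 (λ h a Q g → Q :* (h :* g :+ a :* (h :+ Q :* (h :* g))) := Q :* (h :* ((con 1 :+ a :* Q) :* g) :+ a :* h)) refl _ _ _ _ ⟩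
      Q * (H 1# (suc n) + a * H 1# n) ∎
      where
      Q = q ^ suc n
      g = geo (suc n)

    entry-< : ∀ f {l c} → l < c → entry f l c ≈ 0#
    entry-< f {zero}  {suc c} _         = refl
    entry-< f {suc l} {suc c} (s≤s l<c) = entry-< f l<c

    entry-+ : ∀ f c n → entry f (c ℕ.+ n) c ≈ f n
    entry-+ f zero    n = refl
    entry-+ f (suc c) n = entry-+ f c n

    entry-pred : ∀ f c n → entry f (c ℕ.+ suc n) (suc c) ≈ f n
    entry-pred f c n = trans (reflexive (cong (λ l → entry f l (suc c)) (ℕₚ.+-suc c n))) (entry-+ f c n)

    entry-diagonal : ∀ f c → entry f (c ℕ.+ 0) (suc c) ≈ 0#
    entry-diagonal f c = entry-< f (s≤s (ℕₚ.≤-reflexive (ℕₚ.+-identityʳ c)))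

    data Position (l c : ℕ) : Set where
      above    : l < c → Position l c
      diagonal : l ≡ c ℕ.+ 0 → Position l c
      below    : ∀ n → l ≡ c ℕ.+ suc n → Position l c

    position : ∀ l c → Position l c
    position zero    zero    = diagonal ≡.refl
    position (suc l) zero    = below l ≡.refl
    position zero    (suc c) = above (s≤s z≤n)
    position (suc l) (suc c) with position l c
    ... | above l<c     = above (s≤s l<c)
    ... | diagonal l≡c  = diagonal (cong suc l≡c)
    ... | below n l≡c+n = below n (cong suc l≡c+n)

    entry-pre : ∀ f l c → pre (entry f) l c ≈ entry f l (suc c)
    entry-pre f zero    c = refl
    entry-pre f (suc l) c = refl

    entry-horizontal : ∀ l c → entry (H 1#) l c ≈ entry (H (q * 1#)) l c + pre (entry (H 1#)) l c
    entry-horizontal l c = trans (go (position l c)) (+-congˡ (sym (entry-pre (H 1#) l c)))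
      where
      go : Position l c → entry (H 1#) l c ≈ entry (H (q * 1#)) l c + entry (H 1#) l (suc c)
      go (above l<c) = trans (entry-< _ l<c) (sym (trans
        (+-cong (entry-< _ l<c) (entry-< _ (ℕₚ.m≤n⇒m≤1+n l<c))) (+-identityˡ 0#)))
      go (diagonal ≡.refl) = trans (entry-+ _ c 0) (sym (trans
        (+-cong (entry-+ _ c 0) (entry-diagonal _ c)) (+-identityʳ 1#)))
      go (below n ≡.refl) = trans (entry-+ _ c (suc n)) (trans (H-horizontal n)
        (sym (+-cong (entry-+ _ c (suc n)) (entry-pred _ c n))))

    -- The power q^(l - c) coming from `H-vertical` is distributed as q^l over the rows and q^c over
    -- the columns, so that the determinant can be scaled without negative exponents.
    entry-vertical : ∀ l c → q ^ c * entry (H (q * 1#)) l c ≈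
      q ^ l * (entry (H 1#) l c + a * pre (entry (H 1#)) l c)
    entry-vertical l c = trans (go (position l c)) (*-congˡ (+-congˡ (*-congˡ (sym (entry-pre (H 1#) l c)))))
      where
      go : Position l c → q ^ c * entry (H (q * 1#)) l c ≈
        q ^ l * (entry (H 1#) l c + a * entry (H 1#) l (suc c))
      go (above l<c) = trans (trans (*-congˡ (entry-< _ l<c)) (zeroʳ _)) (sym (trans
        (*-congˡ (trans (+-cong (entry-< _ l<c) (trans (*-congˡ (entry-< _ (ℕₚ.m≤n⇒m≤1+n l<c))) (zeroʳ a))) (+-identityˡ 0#)))
        (zeroʳ _)))
      go (diagonal ≡.refl) = *-cong (reflexive (cong (q ^_) (≡.sym (ℕₚ.+-identityʳ c)))) (trans (entry-+ _ c 0) (sym (trans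
        (+-cong (entry-+ _ c 0) (trans (*-congˡ (entry-diagonal _ c)) (zeroʳ a))) (+-identityʳ 1#))))
      go (below n ≡.refl) = begin
        q ^ c * entry (H (q * 1#)) (c ℕ.+ suc n) c
          ≈⟨ *-congˡ (trans (entry-+ _ c (suc n)) (H-vertical n)) ⟩
        q ^ c * (q ^ suc n * (H 1# (suc n) + a * H 1# n))
          ≈⟨ *-assoc _ _ _ ⟨
        q ^ c * q ^ suc n * (H 1# (suc n) + a * H 1# n)
          ≈⟨ *-cong (^-homo-* q c (suc n)) (+-cong (entry-+ _ c (suc n)) (*-congˡ (entry-pred _ c n))) ⟨
        q ^ (c ℕ.+ suc n) * (entry (H 1#) (c ℕ.+ suc n) c + a * entry (H 1#) (c ℕ.+ suc n) (suc c)) ∎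

    -- Multiplied out, the coefficients make the result vanish for q^l = w.
    entry-eliminate : ∀ u w̄ l c →
      (q ^ l + w̄) * (q ^ c * entry (H (q * u)) l c) ≈
      (q ^ c + w̄) * (q ^ l * entry (H u) l c) + (- u * q ^ c + a * w̄) * (q ^ l * entry (H u) l (suc c))
    entry-eliminate u w̄ l c with position l c
    ... | above l<c = trans
      (trans (*-congˡ (trans (*-congˡ (entry-< _ l<c)) (zeroʳ _))) (zeroʳ _))
      (sym (trans (+-cong
        (trans (*-congˡ (trans (*-congˡ (entry-< _ l<c)) (zeroʳ _))) (zeroʳ _))
        (trans (*-congˡ (trans (*-congˡ (entry-< _ (ℕₚ.m≤n⇒m≤1+n l<c))) (zeroʳ _))) (zeroʳ _))) (+-identityˡ 0#)))
    ... | diagonal ≡.refl = trans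
      (trans (*-congˡ (*-congˡ (trans (entry-+ _ c 0) (sym (entry-+ _ c 0)))))
        (*-cong (+-congʳ qᶜ) (*-congʳ (sym qᶜ))))
      (sym (trans (+-congˡ (trans (*-congˡ (trans (*-congˡ (entry-diagonal _ c)) (zeroʳ _))) (zeroʳ _))) (+-identityʳ _)))
      where
      qᶜ : q ^ (c ℕ.+ 0) ≈ q ^ c
      qᶜ = reflexive (cong (q ^_) (ℕₚ.+-identityʳ c))
    ... | below n ≡.refl = begin
      (q ^ (c ℕ.+ suc n) + w̄) * (C * entry (H (q * u)) (c ℕ.+ suc n) c)
        ≈⟨ *-cong (+-congʳ (^-homo-* q c (suc n))) (*-congˡ (trans (entry-+ _ c (suc n)) (H-shift u n))) ⟩
      (C * Q + w̄) * (C * (Q * (u + a) * x))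
        ≈⟨ solve 7 (λ C Q w u a h x → (C :* Q :+ w) :* (C :* (Q :* (u :+ a) :* x)) :=
             C :* Q :* (con 0 :* (C :* h) :+ (C :* Q :+ w) :* (u :+ a) :* x)) refl C Q w̄ u a (H u n) x ⟩
      -- The solver treats `- u` as an atom, so cancellation is done by hand: a summand with factor
      -- 0 is inserted and rewritten with u - u, which supplies the negative term of the goal.
      C * Q * (0# * (C * H u n) + (C * Q + w̄) * (u + a) * x)
        ≈⟨ *-congˡ (+-congʳ (*-congʳ (-‿inverseʳ u))) ⟨
      C * Q * ((u - u) * (C * H u n) + (C * Q + w̄) * (u + a) * x)
        ≈⟨ solve 8 (λ C Q w u N a h x → C :* Q :* ((u :+ N) :* (C :* h) :+ (C :* Q :+ w) :* (u :+ a) :* x) :=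
             C :* Q :* (u :* C :* (h :+ Q :* x) :+ (C :* a :* Q :* x :+ w :* u :* x) :+ (N :* C :* h :+ a :* w :* x)))
             refl C Q w̄ u (- u) a (H u n) x ⟩
      C * Q * (u * C * (H u n + Q * x) + (C * a * Q * x + w̄ * u * x) + (- u * C * H u n + a * w̄ * x))
        ≈⟨ *-congˡ (+-cong (+-congʳ (*-congˡ (sym (H-geo u n)))) (+-congˡ (*-congˡ (H-geo u n)))) ⟩
      C * Q * (u * C * x + (C * a * Q * x + w̄ * u * x) + (- u * C * H u n + a * w̄ * (H u n + Q * x)))
        ≈⟨ solve 8 (λ C Q w u N a h g → C :* Q :* (u :* C :* (h :* g) :+ (C :* a :* Q :* (h :* g) :+ w :* u :* (h :* g)) :+
               (N :* C :* h :+ a :* w :* (h :+ Q :* (h :* g)))) :=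
             (C :+ w) :* (C :* Q :* (h :* ((u :+ a :* Q) :* g))) :+ (N :* C :+ a :* w) :* (C :* Q :* h))
             refl C Q w̄ u (- u) a (H u n) g ⟩
      (C + w̄) * (C * Q * (H u n * ((u + a * Q) * g))) + (- u * C + a * w̄) * (C * Q * H u n)
        ≈⟨ +-cong (*-congˡ (*-cong (^-homo-* q c (suc n)) (entry-+ _ c (suc n)))) (*-congˡ (*-cong (^-homo-* q c (suc n)) (entry-pred _ c n))) ⟨
      (C + w̄) * (q ^ (c ℕ.+ suc n) * entry (H u) (c ℕ.+ suc n) c) +
        (- u * C + a * w̄) * (q ^ (c ℕ.+ suc n) * entry (H u) (c ℕ.+ suc n) (suc c)) ∎
      where
      C = q ^ c
      Q = q ^ suc n
      g = geo (suc n)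
      x = H u n * g

    om : ℕ → Carrier
    om k = 1# - q ^ k

    geo-om : ∀ {k} → 1 ≤ k → geo k * om k ≈ 1#
    geo-om {suc k} _ = begin
      geo (suc k) * (1# - q ^ suc k)
        ≈⟨ trans (*-distribˡ-- _ _ _) (+-cong (*-identityʳ _) (-‿cong (*-comm _ _))) ⟩
      geo (suc k) - q ^ suc k * geo (suc k)
        ≈⟨ +-congʳ (geo-unfold k) ⟩
      1# + q ^ suc k * geo (suc k) - q ^ suc k * geo (suc k)
        ≈⟨ trans (+-assoc _ _ _) (trans (+-congˡ (-‿inverseʳ _)) (+-identityʳ 1#)) ⟩
      1# ∎

    Π-geo-om : ∀ m ls → All (_< m) ls → Π[ ls ] (λ l → geo (m ∸ l)) * Π[ ls ] (λ l → om (m ∸ l)) ≈ 1#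
    Π-geo-om m []       []         = *-identityˡ 1#
    Π-geo-om m (l ∷ ls) (l<m ∷ ps) = trans (*-interchange _ _ _ _)
      (trans (*-cong (geo-om (ℕₚ.m<n⇒0<n∸m l<m)) (Π-geo-om m ls ps)) (*-identityˡ 1#))

    ^-cancel : ∀ n x y → q ^ n * x ≈ q ^ n * y → x ≈ y
    ^-cancel zero    x y eq = trans (sym (*-identityˡ x)) (trans eq (*-identityˡ y))
    ^-cancel (suc n) x y eq = ^-cancel n x y (q-cancel _ _ (trans (sym (*-assoc _ _ _)) (trans eq (*-assoc _ _ _))))

    Π^-cancel : ∀ ls x y → Π[ ls ] (q ^_) * x ≈ Π[ ls ] (q ^_) * y → x ≈ y
    Π^-cancel []       x y eq = trans (sym (*-identityˡ x)) (trans eq (*-identityˡ y))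
    Π^-cancel (l ∷ ls) x y eq = Π^-cancel ls x y
      (^-cancel l _ _ (trans (sym (*-assoc _ _ _)) (trans eq (*-assoc _ _ _))))

    Π-om : ∀ m ls → All (_< m) ls →
      Π[ ls ] (λ l → q ^ l + - q ^ m) ≈ Π[ ls ] (q ^_) * Π[ ls ] (λ l → om (m ∸ l))
    Π-om m []       []         = sym (*-identityˡ 1#)
    Π-om m (l ∷ ls) (l<m ∷ ps) = trans (*-cong factor (Π-om m ls ps)) (*-interchange _ _ _ _)
      where
      factor : q ^ l - q ^ m ≈ q ^ l * om (m ∸ l)
      factor = sym (trans (*-distribˡ-- _ _ _) (+-cong (*-identityʳ _) (-‿cong
        (trans (sym (^-homo-* q l (m ∸ l))) (reflexive (cong (q ^_) (ℕₚ.m+[n∸m]≡n (ℕₚ.<⇒≤ l<m))))))))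

    shift-< : ∀ x xs → Part (x ∷ xs) → All (_< x ℕ.+ length xs) (shift xs)
    shift-< x []       _        = []
    shift-< x (y ∷ ys) (y≤x , pt) = y+n<x+1+n ∷ All.map (λ p → ℕₚ.<-trans p y+n<x+1+n) (shift-< y ys pt)
      where
      y+n<x+1+n : y ℕ.+ length ys < x ℕ.+ suc (length ys)
      y+n<x+1+n = ℕₚ.+-mono-≤-< y≤x (ℕₚ.n<1+n _)

    downFrom-< : ∀ n {m} → n ≤ m → All (_< m) (downFrom n)
    downFrom-< zero    _   = []
    downFrom-< (suc n) n<m = n<m ∷ downFrom-< n (ℕₚ.<⇒≤ n<m)

    -- The elimination acts on the transposed matrix with w = q^m, where m is the label of the first
    -- part. All modified entries at m vanish, so only the corner `H u x` of the unmodified row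
    -- survives there. Its complementary minor is a scaled determinant for `xs` at `q * u`; the
    -- scalings q^l - q^m and q^c - q^m leave the factors `om` behind.
    JT-eliminate : ∀ u x xs → Part (x ∷ xs) → let m = x ℕ.+ length xs in
      -- The powers of q that `f` and `f̃` place on rows and columns end up on both sides; they are
      -- put in at the start and cancelled.
      H u x * (Π[ shift xs ] (λ l → om (m ∸ l)) * JT (q * u) xs) ≈
      Π[ downFrom (length xs) ] (λ c → om (m ∸ c)) * JT u (x ∷ xs)
    JT-eliminate u x xs pt = Π^-cancel (m ∷ shift xs) _ _ (Π^-cancel (downFrom n) _ _ (begin
      Π[ downFrom n ] (q ^_) * (q ^ m * Π[ ls ] (q ^_) * (H u x * (Π[ ls ] (λ l → om (m ∸ l)) * JT (q * u) xs)))
        ≈⟨ solve 6 (λ D M L h o j → D :* (M :* L :* (h :* (o :* j))) := M :* h :* (L :* o :* (D :* j))) refl _ _ _ _ _ _ ⟩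
      q ^ m * H u x * (Π[ ls ] (q ^_) * Π[ ls ] (λ l → om (m ∸ l)) * (Π[ downFrom n ] (q ^_) * JT (q * u) xs))
        ≈⟨ *-cong (*-congˡ corner) (trans (*-congʳ (sym (Π-om m ls (shift-< x xs pt)))) (sym minor)) ⟩
      f n m * det f̃ (downFrom n) ls
        ≈⟨ trans (+-congˡ (trans (-‿cong (trans (alt-cong ls (λ l ls → trans (*-congˡ (vanish ls)) (zeroʳ _))) (alt-0 ls))) -0#≈0#)) (+-identityʳ _) ⟨
      row-det (f n) f̃ (downFrom n) (m ∷ ls)
        ≈⟨ det-eliminate α β f f̃ (λ c l → entry-eliminate u w̄ l c) n (m ∷ ls) ⟩
      Π[ downFrom n ] α * det f (downFrom (suc n)) (m ∷ ls)
        ≈⟨ *-cong (Π-om m (downFrom n) (downFrom-< n (ℕₚ.m≤n+m n x)))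
             (trans (det-scaleᵀ (q ^_) _ (downFrom (suc n)) (m ∷ ls)) (*-congˡ (sym (det-transpose (entry (H u)) (m ∷ ls) (downFrom (suc n)))))) ⟩
      Π[ downFrom n ] (q ^_) * Π[ downFrom n ] (λ c → om (m ∸ c)) * (q ^ m * Π[ ls ] (q ^_) * JT u (x ∷ xs))
        ≈⟨ solve 4 (λ D o L j → D :* o :* (L :* j) := D :* (L :* (o :* j))) refl _ _ _ _ ⟩
      Π[ downFrom n ] (q ^_) * (q ^ m * Π[ ls ] (q ^_) * (Π[ downFrom n ] (λ c → om (m ∸ c)) * JT u (x ∷ xs))) ∎))
      where
      n m : ℕ
      n = length xs
      m = x ℕ.+ n
      ls : List ℕ
      ls = shift xs
      w̄ : Carrier
      w̄ = - q ^ m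
      α β : ℕ → Carrier
      α c = q ^ c + w̄
      β c = - u * q ^ c + a * w̄
      f f̃ : ℕ → ℕ → Carrier
      f c l = q ^ l * entry (H u) l c
      f̃ c l = (q ^ l + w̄) * (q ^ c * entry (H (q * u)) l c)
      corner : H u x ≈ entry (H u) m n
      corner = sym (trans (reflexive (cong (λ l → entry (H u) l n) (ℕₚ.+-comm x n))) (entry-+ (H u) n x))
      vanish : ∀ ls → det f̃ (downFrom n) (m ∷ ls) ≈ 0#
      vanish ls = trans (det-column f̃ (downFrom n) m ls) (trans
        (alt-cong (downFrom n) (λ c cs → trans (*-congʳ (trans (*-congʳ (-‿inverseʳ (q ^ m))) (zeroˡ _))) (zeroˡ _)))
        (alt-0 (downFrom n)))
      minor : det f̃ (downFrom n) ls ≈ Π[ ls ] (λ l → q ^ l + w̄) * (Π[ downFrom n ] (q ^_) * JT (q * u) xs)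
      minor = trans (det-scaleᵀ (λ l → q ^ l + w̄) _ (downFrom n) ls) (*-congˡ
        (trans (det-scale (q ^_) _ (downFrom n) ls) (*-congˡ (sym (det-transpose (entry (H (q * u))) ls (downFrom n))))))

    H-product : ∀ u n → H u n ≈ Π₁ (λ j → u + a * q ^ j) n * Π₁ geo n
    H-product u zero    = sym (*-identityˡ 1#)
    H-product u (suc n) = trans (*-congʳ (H-product u n))
      (solve 4 (λ x y z w → x :* y :* (z :* w) := z :* x :* (w :* y)) refl _ _ _ _)

    -- Inverting the factors 1 - q^(m - c) completes the denominators of `H u x` to 1 - q^t for t =
    -- 1, ..., m. By `hooks-complement` these t are the hooks of the first row and the differences m
    -- - l, and the latter cancel against the factors beside `JT (q * u) xs`.
    JT-row : ∀ u x xs → Part (x ∷ xs) →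
      JT u (x ∷ xs) ≈ Π₁ (λ j → (u + a * q ^ j) * geo (suc (x ∸ j ℕ.+ conj xs j))) x * JT (q * u) xs
    JT-row u x xs pt@(h , pt′) = begin
      J
        ≈⟨ *-identityˡ J ⟨
      1# * J
        ≈⟨ *-congʳ (Π-geo-om m (downFrom n) (downFrom-< n (ℕₚ.m≤n+m n x))) ⟨
      Π[ downFrom n ] (λ c → geo (m ∸ c)) * Π[ downFrom n ] (λ c → om (m ∸ c)) * J
        ≈⟨ trans (*-assoc _ _ _) (*-congˡ (sym (JT-eliminate u x xs pt))) ⟩
      Π[ downFrom n ] (λ c → geo (m ∸ c)) * (H u x * (O * J′))
        ≈⟨ trans (*-congˡ (*-congʳ (H-product u x)))
             (solve 5 (λ d b g o j → d :* (b :* g :* (o :* j)) := b :* (g :* d) :* (o :* j)) refl _ _ _ _ _) ⟩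
      Π₁ (λ j → u + a * q ^ j) x * (Π₁ geo x * Π[ downFrom n ] (λ c → geo (m ∸ c))) * (O * J′)
        ≈⟨ *-congʳ (*-congˡ (trans (sym (Π-downFrom geo x n)) (sym hooks))) ⟩
      Π₁ (λ j → u + a * q ^ j) x * (Π₁ hk x * Π[ shift xs ] (λ l → geo (m ∸ l))) * (O * J′)
        ≈⟨ solve 5 (λ b h g o j → b :* (h :* g) :* (o :* j) := g :* o :* (b :* h :* j)) refl _ _ _ _ _ ⟩
      Π[ shift xs ] (λ l → geo (m ∸ l)) * O * (Π₁ (λ j → u + a * q ^ j) x * Π₁ hk x * J′)
        ≈⟨ trans (*-congʳ (Π-geo-om m (shift xs) (shift-< x xs pt))) (*-identityˡ _) ⟩
      Π₁ (λ j → u + a * q ^ j) x * Π₁ hk x * J′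
        ≈⟨ *-congʳ (Π₁-* _ hk x) ⟨
      Π₁ (λ j → (u + a * q ^ j) * hk j) x * J′ ∎
      where
      n m : ℕ
      n = length xs
      m = x ℕ.+ n
      J J′ O : Carrier
      J  = JT u (x ∷ xs)
      J′ = JT (q * u) xs
      O  = Π[ shift xs ] (λ l → om (m ∸ l))
      hk : ℕ → Carrier
      hk j = geo (suc (x ∸ j ℕ.+ conj xs j))
      hooks : Π₁ hk x * Π[ shift xs ] (λ l → geo (m ∸ l)) ≈ Π₁ geo m
      hooks = ≡.subst
        (λ x → Π₁ (λ j → geo (suc (x ∸ j ℕ.+ conj xs j))) x * Π[ shift xs ] (λ l → geo (x ℕ.+ n ∸ l)) ≈ Π₁ geo (x ℕ.+ n))
        (ℕₚ.m+[n∸m]≡n h) (hooks-complement geo 0 (x ∸ head₀ xs) xs pt′)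

    JT-zeros : ∀ u xs → Part xs → sum xs ≡ 0 → JT u xs ≈ 1#
    JT-zeros u []         _        _  = refl
    JT-zeros u (zero ∷ xs) (h , pt) eq =
      trans (JT-row u zero xs (h , pt)) (trans (*-identityˡ _) (JT-zeros (q * u) xs pt eq))

    JT-horizontal : ∀ xs → Part xs → JT 1# xs ≈ Σ[ hStrips xs ] (JT (q * 1#))
    JT-horizontal xs pt = trans
      (det-horizontal _ _ entry-horizontal xs pt (downFrom (length xs)))
      (Σ-cong-∈ (hStrips xs) (λ {ys} ys∈ → reflexive (cong (λ n → det (entry (H (q * 1#))) (shift ys) (downFrom n))
        (≡.sym (HStrip-length (∈-hStrips⁻ xs pt ys∈))))))

    -- The row labels exceed the column labels n - 1, ..., 0 by the parts of the partition. This
    -- excess is the factor q^|λ| of the vertical recursion.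
    Π-shift : ∀ xs → Π[ shift xs ] (q ^_) ≈ Π[ downFrom (length xs) ] (q ^_) * q ^ sum xs
    Π-shift []       = sym (*-identityˡ 1#)
    Π-shift (x ∷ xs) = begin
      q ^ (x ℕ.+ length xs) * Π[ shift xs ] (q ^_)
        ≈⟨ *-cong (^-homo-* q x (length xs)) (Π-shift xs) ⟩
      q ^ x * q ^ length xs * (Π[ downFrom (length xs) ] (q ^_) * q ^ sum xs)
        ≈⟨ solve 4 (λ x n p s → x :* n :* (p :* s) := n :* p :* (x :* s)) refl _ _ _ _ ⟩
      q ^ length xs * Π[ downFrom (length xs) ] (q ^_) * (q ^ x * q ^ sum xs)
        ≈⟨ *-congˡ (^-homo-* q x (sum xs)) ⟨
      q ^ length xs * Π[ downFrom (length xs) ] (q ^_) * q ^ (x ℕ.+ sum xs) ∎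

    JT-vertical : ∀ xs → Part xs →
      JT (q * 1#) xs ≈ q ^ sum xs * Σ[ vStrips xs ] (λ ys → a ^ defect xs ys * JT 1# ys)
    JT-vertical xs pt = Π^-cancel (downFrom (length xs)) _ _ (begin
      Π[ cs ] (q ^_) * JT (q * 1#) xs
        ≈⟨ det-scaleᵀ (q ^_) (entry (H (q * 1#))) (shift xs) cs ⟨
      det (λ l c → q ^ c * entry (H (q * 1#)) l c) (shift xs) cs
        ≈⟨ det-cong (shift xs) cs entry-vertical ⟩
      det (λ l c → q ^ l * (entry (H 1#) l c + a * pre (entry (H 1#)) l c)) (shift xs) cs
        ≈⟨ det-scale (q ^_) _ (shift xs) cs ⟩
      Π[ shift xs ] (q ^_) * det (λ l c → entry (H 1#) l c + a * pre (entry (H 1#)) l c) (shift xs) cs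
        ≈⟨ *-cong (Π-shift xs) (det-vertical a (entry (H 1#)) xs pt cs) ⟩
      Π[ cs ] (q ^_) * q ^ sum xs * Σ[ vStrips xs ] (λ ys → a ^ defect xs ys * det (entry (H 1#)) (shift ys) cs)
        ≈⟨ trans (*-assoc _ _ _) (*-congˡ (*-congˡ (Σ-cong-∈ (vStrips xs) (λ {ys} ys∈ →
             *-congˡ (reflexive (cong (λ n → det (entry (H 1#)) (shift ys) (downFrom n))
               (≡.sym (VStrip-length (∈-vStrips⁻ xs pt ys∈))))))))) ⟩
      Π[ cs ] (q ^_) * (q ^ sum xs * Σ[ vStrips xs ] (λ ys → a ^ defect xs ys * JT 1# ys)) ∎)
      where
      cs : List ℕ
      cs = downFrom (length xs)

-- Formal power series over a commutative ring

module PowerSeries {c ℓ} (R : CommutativeRing c ℓ) where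
  open CommutativeRing R hiding (zero)
  open NaturalCoefficients commutativeSemiring using (solve; _:=_; _:+_; _:*_; con)
  open SetoidReasoning setoid

  -- Recursion that shifts the first factor takes the place of a sum over i and n - i, so the ring
  -- laws follow by induction without truncated subtraction.
  conv : (ℕ → Carrier) → (ℕ → Carrier) → ℕ → Carrier
  conv f g zero    = f 0 * g 0
  conv f g (suc n) = f 0 * g (suc n) + conv (λ i → f (suc i)) g n

  const : Carrier → ℕ → Carrier
  const x zero    = x
  const x (suc n) = 0#

  conv-cong : ∀ {f f′ g g′} → (∀ n → f n ≈ f′ n) → (∀ n → g n ≈ g′ n) → ∀ n → conv f g n ≈ conv f′ g′ n
  conv-cong f≈ g≈ zero    = *-cong (f≈ 0) (g≈ 0)
  conv-cong f≈ g≈ (suc n) = +-cong (*-cong (f≈ 0) (g≈ (suc n))) (conv-cong (λ i → f≈ (suc i)) g≈ n)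

  conv-distribʳ : ∀ h f g n → conv (λ i → f i + g i) h n ≈ conv f h n + conv g h n
  conv-distribʳ h f g zero    = distribʳ _ _ _
  conv-distribʳ h f g (suc n) = trans (+-congˡ (conv-distribʳ h _ _ n))
    (solve 5 (λ f g h x y → (f :+ g) :* h :+ (x :+ y) := f :* h :+ x :+ (g :* h :+ y)) refl _ _ _ _ _)

  conv-*ˡ : ∀ k f g n → conv (λ i → k * f i) g n ≈ k * conv f g n
  conv-*ˡ k f g zero    = *-assoc _ _ _
  conv-*ˡ k f g (suc n) = trans (+-cong (*-assoc _ _ _) (conv-*ˡ k _ g n)) (sym (distribˡ k _ _))

  conv-0 : ∀ g n → conv (λ _ → 0#) g n ≈ 0#
  conv-0 g zero    = zeroˡ _
  conv-0 g (suc n) = trans (+-cong (zeroˡ _) (conv-0 g n)) (+-identityˡ 0#)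

  conv-const : ∀ x g n → conv (const x) g n ≈ x * g n
  conv-const x g zero    = refl
  conv-const x g (suc n) = trans (+-congˡ (conv-0 g n)) (+-identityʳ _)

  conv-last : ∀ f g n → conv f g (suc n) ≈ conv f (λ i → g (suc i)) n + f (suc n) * g 0
  conv-last f g zero    = refl
  conv-last f g (suc n) = trans (+-congˡ (conv-last (λ i → f (suc i)) g n)) (sym (+-assoc _ _ _))

  conv-comm : ∀ f g n → conv f g n ≈ conv g f n
  conv-comm f g zero    = *-comm _ _
  conv-comm f g (suc n) = begin
    f 0 * g (suc n) + conv (λ i → f (suc i)) g n ≈⟨ +-cong (*-comm _ _) (conv-comm _ g n) ⟩
    g (suc n) * f 0 + conv g (λ i → f (suc i)) n ≈⟨ +-comm _ _ ⟩
    conv g (λ i → f (suc i)) n + g (suc n) * f 0 ≈⟨ conv-last g f n ⟨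
    conv g f (suc n) ∎

  conv-assoc : ∀ f g h n → conv (conv f g) h n ≈ conv f (conv g h) n
  conv-assoc f g h zero    = *-assoc _ _ _
  conv-assoc f g h (suc n) = begin
    f 0 * g 0 * h (suc n) + conv (λ i → f 0 * g (suc i) + conv (λ i → f (suc i)) g i) h n
      ≈⟨ +-congˡ (trans (conv-distribʳ h _ _ n) (+-cong (conv-*ˡ (f 0) _ h n) (conv-assoc _ g h n))) ⟩
    f 0 * g 0 * h (suc n) + (f 0 * conv (λ i → g (suc i)) h n + conv (λ i → f (suc i)) (conv g h) n)
      ≈⟨ solve 5 (λ f g h x y → f :* g :* h :+ (f :* x :+ y) := f :* (g :* h :+ x) :+ y) refl _ _ _ _ _ ⟩
    conv f (conv g h) (suc n) ∎

  series : CommutativeRing c ℓ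
  series = record
    { Carrier = ℕ → Carrier
    ; _≈_ = λ f g → ∀ n → f n ≈ g n
    ; _+_ = λ f g n → f n + g n
    ; _*_ = conv
    ; -_ = λ f n → - f n
    ; 0# = λ _ → 0#
    ; 1# = const 1#
    ; isCommutativeRing = record
      { isRing = record
        { +-isAbelianGroup = Pointwise.isAbelianGroup ℕ +-isAbelianGroup
        ; *-cong = conv-cong
        ; *-assoc = conv-assoc
        ; *-identity = identityˡ , λ f n → trans (conv-comm f (const 1#) n) (identityˡ f n)
        ; distrib = (λ h f g n → trans (conv-comm h _ n) (trans (conv-distribʳ h f g n)
                      (+-cong (conv-comm f h n) (conv-comm g h n))))
                  , conv-distribʳ
        }
      ; *-comm = conv-comm
      }
    }
    where
    identityˡ : ∀ f n → conv (const 1#) f n ≈ f n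
    identityˡ f n = trans (conv-const 1# f n) (*-identityˡ _)

  module S = CommutativeRing series
  open Exp semiring using (_^_)
  open Exp S.semiring using () renaming (_^_ to _^ˢ_)

  var : ℕ → Carrier
  var zero    = 0#
  var (suc n) = const 1# n

  var-*-zero : ∀ f → conv var f 0 ≈ 0#
  var-*-zero f = zeroˡ _

  var-*-suc : ∀ f n → conv var f (suc n) ≈ f n
  var-*-suc f n = trans (+-cong (zeroˡ _) (trans (conv-const 1# f n) (*-identityˡ _))) (+-identityˡ _)

  var-cancel : ∀ f g → var S.* f S.≈ var S.* g → f S.≈ g
  var-cancel f g eq n = trans (sym (var-*-suc f n)) (trans (eq (suc n)) (var-*-suc g n))

  var^-*-< : ∀ s f {n} → n < s → conv (var ^ˢ s) f n ≈ 0#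
  var^-*-< (suc s) f {zero}  _         = trans (conv-assoc var (var ^ˢ s) f 0) (var-*-zero (conv (var ^ˢ s) f))
  var^-*-< (suc s) f {suc n} (s≤s n<s) =
    trans (conv-assoc var _ f (suc n)) (trans (var-*-suc (conv (var ^ˢ s) f) n) (var^-*-< s f n<s))

  var^-*-≤ : ∀ s f {n} → s ≤ n → conv (var ^ˢ s) f n ≈ f (n ∸ s)
  var^-*-≤ zero    f _ = S.*-identityˡ f _
  var^-*-≤ (suc s) f {suc n} (s≤s s≤n) =
    trans (conv-assoc var _ f (suc n)) (trans (var-*-suc (conv (var ^ˢ s) f) n) (var^-*-≤ s f s≤n))

  const^-* : ∀ x d f n → conv (const x ^ˢ d) f n ≈ x ^ d * f n
  const^-* x zero    f n = conv-const 1# f n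
  const^-* x (suc d) f n = trans (conv-assoc (const x) _ f n) (trans (conv-const x _ n)
    (trans (*-congˡ (const^-* x d f n)) (sym (*-assoc _ _ _))))

  var^-self : ∀ s → (var ^ˢ s) s ≈ 1#
  var^-self zero    = refl
  var^-self (suc s) = trans (var-*-suc (var ^ˢ s) s) (var^-self s)

  var^-other : ∀ s n → ¬ n ≡ s → (var ^ˢ s) n ≈ 0#
  var^-other zero    zero    n≢s = ⊥-elim (n≢s ≡.refl)
  var^-other zero    (suc n) n≢s = refl
  var^-other (suc s) zero    n≢s = var-*-zero (var ^ˢ s)
  var^-other (suc s) (suc n) n≢s = trans (var-*-suc (var ^ˢ s) n) (var^-other s n (λ eq → n≢s (cong suc eq)))

-- Integer power series in a and then q, and the images of the counting series

module A = PowerSeries ℤₚ.+-*-commutativeRing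
module Q = PowerSeries A.series

Rq : CommutativeRing _ _
Rq = Q.series

module Rq = CommutativeRing Rq
open Exp Rq.semiring using () renaming (_^_ to _^q_)
open Determinants Rq using (Σ[_]; Σ-*ˡ; Π[_]; Π-cong; Π-++; Π-map)
open RangeProducts Rq using (Π₁; Π₁-cong; Π-upTo)

q̂ â : Rq.Carrier
q̂ = Q.var
â = Q.const A.var

⟦_⟧ : Series → Rq.Carrier
⟦ f ⟧ n k = + f n k

-- Needed because `sumTo` splits off its last term whereas `conv` splits off its first.
sumTo-suc : ∀ n f → sumTo (suc n) f ≡ f 0 ℕ.+ sumTo n (λ i → f (suc i))
sumTo-suc zero    f = ≡.refl
sumTo-suc (suc n) f = ≡.trans (cong (ℕ._+ f (suc (suc n))) (sumTo-suc n f)) (ℕₚ.+-assoc (f 0) _ _)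

⟦⟧-conv₁ : ∀ (f g : ℕ → ℕ) k → A.conv (λ i → + f i) (λ i → + g i) k ≡ + sumTo k (λ j → f j ℕ.* g (k ∸ j))
⟦⟧-conv₁ f g zero    = ≡.sym (ℤₚ.pos-* (f 0) (g 0))
⟦⟧-conv₁ f g (suc k) = ≡.trans
  (cong₂ ℤ._+_ (≡.sym (ℤₚ.pos-* (f 0) (g (suc k)))) (⟦⟧-conv₁ (λ i → f (suc i)) g k))
  (cong +_ (≡.sym (sumTo-suc k (λ j → f j ℕ.* g (suc k ∸ j)))))

⟦⟧-* : ∀ f g → ⟦ f *S g ⟧ Rq.≈ ⟦ f ⟧ Rq.* ⟦ g ⟧
⟦⟧-* f g n k = ≡.sym (go f n)
  where
  go : ∀ f n → Q.conv ⟦ f ⟧ ⟦ g ⟧ n k ≡ + sumTo n (λ i → sumTo k (λ j → f i j ℕ.* g (n ∸ i) (k ∸ j)))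
  go f zero    = ⟦⟧-conv₁ (f 0) (g 0) k
  go f (suc n) = ≡.trans (cong₂ ℤ._+_ (⟦⟧-conv₁ (f 0) (g (suc n)) k) (go (λ i → f (suc i)) n))
    (cong +_ (≡.sym (sumTo-suc n (λ i → sumTo k (λ j → f i j ℕ.* g (suc n ∸ i) (k ∸ j))))))

⟦⟧-one : ⟦ oneS ⟧ Rq.≈ Rq.1#
⟦⟧-one zero    zero    = ≡.refl
⟦⟧-one zero    (suc k) = ≡.refl
⟦⟧-one (suc n) k       = ≡.refl

⟦⟧-prodS : ∀ fs → ⟦ prodS fs ⟧ Rq.≈ Π[ fs ] ⟦_⟧
⟦⟧-prodS []       = ⟦⟧-one
⟦⟧-prodS (f ∷ fs) = Rq.trans {⟦ f *S prodS fs ⟧} (⟦⟧-* f (prodS fs)) (Rq.*-congˡ {⟦ f ⟧} (⟦⟧-prodS fs))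

^q-coefficient : ∀ i n k → (q̂ ^q i) n k ≡ + ind (⌊ n ≟ i ⌋ ∧ ⌊ k ≟ 0 ⌋)
^q-coefficient i n k with n ≟ i
... | yes ≡.refl = ≡.trans (Q.var^-self n k) (one k)
  where
  one : ∀ k → A.const (+ 1) k ≡ + ind ⌊ k ≟ 0 ⌋
  one zero    = ≡.refl
  one (suc k) = ≡.refl
... | no  n≢i    = Q.var^-other i n n≢i k

â-*-zero : ∀ f n → (â Rq.* f) n 0 ≡ + 0
â-*-zero f n = ≡.trans (Q.conv-const A.var f n 0) (A.var-*-zero (f n))

â-*-suc : ∀ f n k → (â Rq.* f) n (suc k) ≡ f n k
â-*-suc f n k = ≡.trans (Q.conv-const A.var f n (suc k)) (A.var-*-suc (f n) k)

⟦⟧-binom : ∀ i j → ⟦ binom i j ⟧ Rq.≈ (q̂ ^q i) Rq.+ (â Rq.* (q̂ ^q j))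
⟦⟧-binom i j n k = cong₂ ℤ._+_ (≡.sym (^q-coefficient i n k)) (≡.sym (shifted k))
  where
  shifted : ∀ k → (â Rq.* (q̂ ^q j)) n k ≡ + ind (⌊ n ≟ j ⌋ ∧ ⌊ k ≟ 1 ⌋)
  shifted zero    = ≡.trans (â-*-zero (q̂ ^q j) n) (cong (λ b → + ind b) (≡.sym (Boolₚ.∧-zeroʳ _)))
  shifted (suc k) = ≡.trans (â-*-suc (q̂ ^q j) n k) (≡.trans (^q-coefficient j n k)
    (cong (λ b → + ind (⌊ n ≟ j ⌋ ∧ b)) (≟-pred k)))
    where
    ≟-pred : ∀ k → ⌊ k ≟ 0 ⌋ ≡ ⌊ suc k ≟ 1 ⌋
    ≟-pred zero    = ≡.refl
    ≟-pred (suc k) = ≡.refl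

⌊⌋-true : ∀ {p} {P : Set p} (P? : Dec P) → P → ⌊ P? ⌋ ≡ true
⌊⌋-true P? p = ≡.trans (isYes≗does P?) (dec-true P? p)

⌊⌋-false : ∀ {p} {P : Set p} (P? : Dec P) → ¬ P → ⌊ P? ⌋ ≡ false
⌊⌋-false P? ¬p = ≡.trans (isYes≗does P?) (dec-false P? ¬p)

-- Multiplication by q^(h + 1) shifts degrees by h + 1. Below that degree only 0 is divisible by h +
-- 1, and from there on the shift preserves divisibility.
⟦geom⟧-unfold : ∀ h → ⟦ geom (suc h) ⟧ Rq.≈ Rq.1# Rq.+ (q̂ ^q suc h) Rq.* ⟦ geom (suc h) ⟧
⟦geom⟧-unfold h n k with n ℕ.<? suc h
... | yes n<h = ≡.trans (small n n<h k)
        (≡.trans (≡.sym (ℤₚ.+-identityʳ _)) (cong (λ z → Rq.1# n k ℤ.+ z) (≡.sym (Q.var^-*-< (suc h) ⟦ geom (suc h) ⟧ n<h k))))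
  where
  small : ∀ n → n < suc h → ∀ k → ⟦ geom (suc h) ⟧ n k ≡ Rq.1# n k
  small zero    _   zero    = ≡.refl
  small zero    _   (suc k) = ≡.refl
  small (suc n) n<h k =
    cong (λ b → + ind (b ∧ ⌊ k ≟ 0 ⌋)) (⌊⌋-false (suc h ∣? suc n) (λ h∣n → ℕₚ.<⇒≱ n<h (∣⇒≤ h∣n)))
... | no  n≮h = ≡.trans (large n (ℕₚ.≮⇒≥ n≮h)) (cong (λ z → Rq.1# n k ℤ.+ z)
        (≡.sym (Q.var^-*-≤ (suc h) ⟦ geom (suc h) ⟧ (ℕₚ.≮⇒≥ n≮h) k)))
  where
  same : ∀ m → ⌊ suc h ∣? (suc h ℕ.+ m) ⌋ ≡ ⌊ suc h ∣? m ⌋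
  same m with suc h ∣? m
  ... | yes h∣m = ⌊⌋-true (suc h ∣? (suc h ℕ.+ m)) (∣m∣n⇒∣m+n ∣-refl h∣m)
  ... | no  h∤m = ⌊⌋-false (suc h ∣? (suc h ℕ.+ m)) (λ h∣ → h∤m (∣m+n∣m⇒∣n h∣ ∣-refl))
  large : ∀ n → suc h ≤ n → ⟦ geom (suc h) ⟧ n k ≡ Rq.1# n k ℤ.+ ⟦ geom (suc h) ⟧ (n ∸ suc h) k
  large (suc n) (s≤s h≤n) = ≡.trans
    (cong (λ b → + ind (b ∧ ⌊ k ≟ 0 ⌋))
      (≡.trans (cong (λ m → ⌊ suc h ∣? m ⌋) (≡.sym (ℕₚ.m+[n∸m]≡n (s≤s h≤n)))) (same (n ∸ h))))
    (≡.sym (ℤₚ.+-identityˡ _))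

open ≡ using (refl; sym; trans; subst; subst₂)

-- Enumerations without repetition

interval-unique : ∀ y d → Unique (interval y d)
interval-unique y zero    = [] ∷ []
interval-unique y (suc d) =
  All.tabulate (λ z∈ eq → ℕₚ.<⇒≱ (ℕₚ.≤-reflexive eq) (proj₂ (interval⁻ y d z∈))) ∷ interval-unique y d

vChoices-unique : ∀ x xs ys → Unique (vChoices x xs ys)
vChoices-unique zero    xs ys = [] ∷ []
vChoices-unique (suc x) xs ys with head₀ ys ≤? x
... | yes _ = (ℕₚ.1+n≢n ∷ []) ∷ [] ∷ []
... | no  _ = [] ∷ []

strips-unique : ∀ choices → (∀ x xs ys → Unique (choices x xs ys)) → ∀ xs → Unique (strips choices xs)
strips-unique choices u []       = [] ∷ []
strips-unique choices u (x ∷ xs) = go (strips choices xs) (strips-unique choices u xs)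
  where
  ∷-tail : ∀ yss {z zs} → z ∷ zs ∈ concatMap (λ ys → map (_∷ ys) (choices x xs ys)) yss → zs ∈ yss
  ∷-tail (ys ∷ yss) p with ∈-++⁻ (map (_∷ ys) (choices x xs ys)) p
  ... | inj₁ q with ∈-map⁻ (_∷ ys) q
  ...   | _ , _ , refl = here refl
  ∷-tail (ys ∷ yss) p | inj₂ q = there (∷-tail yss q)
  go : ∀ yss → Unique yss → Unique (concatMap (λ ys → map (_∷ ys) (choices x xs ys)) yss)
  go []         []       = []
  go (ys ∷ yss) (n ∷ us) = Uniqueₚ.++⁺ (Uniqueₚ.map⁺ (λ { refl → refl }) (u x xs ys)) (go yss us) disjoint
    where
    disjoint : ∀ {zs} → ¬ (zs ∈ map (_∷ ys) (choices x xs ys) ×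
                           zs ∈ concatMap (λ ys → map (_∷ ys) (choices x xs ys)) yss)
    disjoint (p , q) with ∈-map⁻ (_∷ ys) p
    ... | _ , _ , refl = All.lookup n (∷-tail yss q) refl

-- The length is compared in the integers because `c` will be a coefficient of a determinant;
-- injectivity of `+_` leads back to natural numbers at the very end.
Enum : (Filling → Set) → ℤ → Set
Enum P c = Σ (List Filling) λ L → Unique L × (∀ F → (F ∈ L → P F) × (P F → F ∈ L)) × + length L ≡ c

enum-empty : ∀ {P} → (∀ F → ¬ P F) → Enum P (+ 0)
enum-empty ¬P = [] , [] , (λ F → (λ ()) , λ p → ⊥-elim (¬P F p)) , refl

unique-map : ∀ {X Y : Set} (t : X → Y) {L} → (∀ {x y} → x ∈ L → y ∈ L → t x ≡ t y → x ≡ y) →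
             Unique L → Unique (map t L)
unique-map t inj []       = []
unique-map t inj (n ∷ us) =
  Allₚ.map⁺ (All.tabulate (λ y∈ eq → All.lookup n y∈ (inj (here refl) (there y∈) eq))) ∷
  unique-map t (λ x∈ y∈ → inj (there x∈) (there y∈)) us

enum-map : ∀ {P Q c} (to from : Filling → Filling) →
  (∀ F → P F → Q (to F) × from (to F) ≡ F) → (∀ F → Q F → P (from F) × to (from F) ≡ F) →
  Enum P c → Enum Q c
enum-map {P} {Q} to from P⇒Q Q⇒P (L , u , mem , len) =
  map to L ,
  unique-map to (λ x∈ y∈ eq → trans (sym (inv x∈)) (trans (cong from eq) (inv y∈))) u ,
  (λ F → sound F , complete F) ,
  trans (cong +_ (length-map to L)) len
  where
  inv : ∀ {F} → F ∈ L → from (to F) ≡ F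
  inv {F} F∈ = proj₂ (P⇒Q F (proj₁ (mem F) F∈))
  sound : ∀ F → F ∈ map to L → Q F
  sound F F∈ with ∈-map⁻ to F∈
  ... | F′ , F′∈ , refl = proj₁ (P⇒Q F′ (proj₁ (mem F′) F′∈))
  complete : ∀ F → Q F → F ∈ map to L
  complete F QF = let P′ , eq = Q⇒P F QF in
    subst (_∈ map to L) eq (∈-map⁺ to (proj₂ (mem (from F)) P′))

enum-iff : ∀ {P Q c} → (∀ F → P F → Q F) → (∀ F → Q F → P F) → Enum P c → Enum Q c
enum-iff P⇒Q Q⇒P = enum-map (λ F → F) (λ F → F) (λ F p → P⇒Q F p , refl) (λ F q → Q⇒P F q , refl)

-- Since a filling determines its index x, the lists for different x are disjoint, and lengths add
-- up as coefficients do.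
enum-Σ : ∀ {X : Set} (xs : List X) (P : X → Filling → Set) (f : X → Rq.Carrier) n k →
  (∀ {x y F} → P x F → P y F → x ≡ y) → Unique xs →
  (∀ {x} → x ∈ xs → Enum (P x) (f x n k)) →
  Enum (λ F → Σ X λ x → x ∈ xs × P x F) ((Σ[ xs ] f) n k)
enum-Σ []       P f n k fun _        e = enum-empty (λ { _ (_ , () , _) })
enum-Σ {X} (x ∷ xs) P f n k fun (x∉ ∷ u) e
  with e (here refl) | enum-Σ xs P f n k fun u (λ x∈ → e (there x∈))
... | L , uL , memL , lenL | M , uM , memM , lenM =
  L ++ M ,
  Uniqueₚ.++⁺ uL uM (λ { (p , q) → let y , y∈ , Py = proj₁ (memM _) q in
    All.lookup x∉ y∈ (fun (proj₁ (memL _) p) Py) }) ,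
  (λ F → sound F , complete F) ,
  trans (cong +_ (length-++ L)) (cong₂ ℤ._+_ lenL lenM)
  where
  sound : ∀ F → F ∈ L ++ M → Σ X λ y → y ∈ x ∷ xs × P y F
  sound F F∈ with ∈-++⁻ L F∈
  ... | inj₁ p = x , here refl , proj₁ (memL F) p
  ... | inj₂ q = let y , y∈ , Py = proj₁ (memM F) q in y , there y∈ , Py
  complete : ∀ F → (Σ X λ y → y ∈ x ∷ xs × P y F) → F ∈ L ++ M
  complete F (_ , here refl , Py) = ∈-++⁺ˡ (proj₂ (memL F) Py)
  complete F (y , there y∈  , Py) = ∈-++⁺ʳ L (proj₂ (memM F) (y , y∈ , Py))

-- Fillings row by row, and the removal of one layer of equal entries

RowRel ColRel : Entry → Entry → Set
RowRel (v , b) (v′ , b′) = v′ ≤ v × (b ≡ true → v′ < v)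
ColRel (v , b) (v′ , b′) = v′ ≤ v × (v′ ≡ v → b′ ≡ true)

-- Only the upper row may be longer, so the relation also records that row lengths decrease weakly.
data Above : List Entry → List Entry → Set where
  []  : ∀ {upper} → Above upper []
  _∷_ : ∀ {e e′ upper lower} → ColRel e e′ → Above upper lower → Above (e ∷ upper) (e′ ∷ lower)

firstRow : Filling → List Entry
firstRow []      = []
firstRow (r ∷ _) = r

Valid : (Entry → Set) → Filling → Set
Valid A []      = ⊤
Valid A (r ∷ F) = All A r × Linked RowRel r × Above r (firstRow F) × Valid A F

shapeOf : Filling → List ℕ
shapeOf = map length

head₀-shapeOf : ∀ F → head₀ (shapeOf F) ≡ length (firstRow F)
head₀-shapeOf []      = refl
head₀-shapeOf (_ ∷ _) = refl

Above-length : ∀ {u l} → Above u l → length l ≤ length u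
Above-length []      = z≤n
Above-length (_ ∷ p) = s≤s (Above-length p)

data Kind : Set where
  vert horiz : Kind

Strip : Kind → List ℕ → List ℕ → Set
Strip vert  = VStrip
Strip horiz = HStrip

RowBound : Kind → ℕ → Set
RowBound vert  d = d ≤ 1
RowBound horiz d = ⊤

-- Here x₂ is the outer length of the next row, and x and y are the outer and inner lengths of the
-- current one. In a horizontal strip no cell may lie below a strip cell; in a vertical one only the
-- outer shape is constrained.
ColBound : Kind → ℕ → ℕ → ℕ → Set
ColBound vert  x₂ x y = x₂ ≤ x
ColBound horiz x₂ x y = x₂ ≤ y

strip-[]ˡ : ∀ κ {y ys} → ¬ Strip κ [] (y ∷ ys)
strip-[]ˡ vert  ()
strip-[]ˡ horiz ()

strip-[]ʳ : ∀ κ {x xs} → ¬ Strip κ (x ∷ xs) []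
strip-[]ʳ vert  ()
strip-[]ʳ horiz ()

strip-[] : ∀ κ → Strip κ [] []
strip-[] vert  = []
strip-[] horiz = []

RowBound-1 : ∀ κ {d} → d ≤ 1 → RowBound κ d
RowBound-1 vert  d≤1 = d≤1
RowBound-1 horiz _   = tt

RowBound-2 : ∀ κ {d} → RowBound κ (suc (suc d)) → κ ≡ horiz × RowBound κ (suc d)
RowBound-2 vert  (s≤s ())
RowBound-2 horiz _ = refl , tt

RowBound-horiz : ∀ {κ d} → κ ≡ horiz → RowBound κ d
RowBound-horiz refl = tt

ColBound-0 : ∀ κ {x y} → ColBound κ 0 x y
ColBound-0 vert  = z≤n
ColBound-0 horiz = z≤n

ColBound-suc : ∀ κ {x y z} → ColBound κ x y z → ColBound κ (suc x) (suc y) (suc z)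
ColBound-suc vert  b = s≤s b
ColBound-suc horiz b = s≤s b

ColBound-pred : ∀ κ {x y z} → ColBound κ (suc x) (suc y) (suc z) → ColBound κ x y z
ColBound-pred vert  (s≤s b) = b
ColBound-pred horiz (s≤s b) = b

ColBound-00 : ∀ κ {x} → ¬ ColBound κ (suc x) 0 0
ColBound-00 vert  ()
ColBound-00 horiz ()

ColBound-vert : ∀ κ {x y} → ColBound κ (suc x) (suc y) 0 → κ ≡ vert × ColBound κ x y 0
ColBound-vert vert (s≤s b) = refl , b

ColBound-vert⁻ : ∀ {κ x y} → κ ≡ vert → ColBound κ x y 0 → ColBound κ (suc x) (suc y) 0
ColBound-vert⁻ refl b = s≤s b

strip-intro : ∀ κ {xs ys} y d → RowBound κ d → head₀ ys ≤ y → ColBound κ (head₀ xs) (y ℕ.+ d) y →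
              Strip κ xs ys → Strip κ (y ℕ.+ d ∷ xs) (y ∷ ys)
strip-intro vert  y zero       _ h _ p rewrite ℕₚ.+-identityʳ y = keep h p
strip-intro vert  y (suc zero) _ h _ p rewrite ℕₚ.+-comm y 1    = drop h p
strip-intro vert  y (suc (suc d)) (s≤s ()) h _ p
strip-intro horiz y d          _ h c p = cons c (ℕₚ.m≤m+n y d) p

strip-elim : ∀ κ {x y xs ys} → head₀ xs ≤ x → Strip κ (x ∷ xs) (y ∷ ys) →
  y ≤ x × RowBound κ (x ∸ y) × ColBound κ (head₀ xs) x y × Strip κ xs ys
strip-elim vert  {x} h (keep _ p)   = ℕₚ.≤-refl , subst (_≤ 1) (sym (ℕₚ.n∸n≡0 x)) z≤n , h , p
strip-elim vert  {suc x} h (drop _ p) = ℕₚ.n≤1+n x , ℕₚ.≤-reflexive (ℕₚ.m+n∸n≡m 1 x) , h , p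
strip-elim horiz h (cons c l p) = l , tt , c , p

overlined : List Entry → ℕ
overlined row = length (filter (λ e → proj₂ e Bool.≟ true) row)

Filled : (Entry → Set) → List ℕ → ℕ → ℕ → Filling → Set
Filled A xs n k F = Valid A F × shapeOf F ≡ xs × size F ≡ n × overlines F ≡ k

-- One layer of a filling over the alphabet A: the entries x₀ form a strip of
-- kind κ, and the remaining ones are the images under f of a filling over A′.
record Layer : Set₁ where
  field
    κ            : Kind
    A A′         : Entry → Set
    s            : ℕ
    x₀           : Entry
    f            : Entry → Entry
    g            : Entry → Maybe Entry
    f-value      : ∀ e → proj₁ (f e) ≡ s ℕ.+ proj₁ e
    f-overlined  : ∀ e → proj₂ (f e) ≡ proj₂ e
    x₀-value     : proj₁ x₀ ≡ s
    A-f          : ∀ {e} → A′ e → A (f e)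
    A-x₀         : A x₀
    g-f          : ∀ {e} → A′ e → g (f e) ≡ just e
    g-x₀         : g x₀ ≡ nothing
    view         : ∀ {e} → A e → e ≡ x₀ ⊎ Σ Entry λ e′ → A′ e′ × e ≡ f e′
    row-f-x₀     : ∀ {e} → A′ e → RowRel (f e) x₀
    row-x₀-f     : ∀ {e} → A′ e → ¬ RowRel x₀ (f e)
    col-f-x₀     : ∀ {e} → A′ e → ColRel (f e) x₀
    col-x₀-f     : ∀ {e} → A′ e → ¬ ColRel x₀ (f e)
    row-x₀       : κ ≡ horiz → RowRel x₀ x₀
    row-x₀⁻      : RowRel x₀ x₀ → κ ≡ horiz
    col-x₀       : κ ≡ vert → ColRel x₀ x₀
    col-x₀⁻      : ColRel x₀ x₀ → κ ≡ vert

module Peel (layer : Layer) where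
  open Layer layer

  row-f : ∀ {e e′} → RowRel e e′ → RowRel (f e) (f e′)
  row-f {e} {e′} (le , lt) rewrite f-value e | f-value e′ | f-overlined e =
    ℕₚ.+-monoʳ-≤ s le , λ b → ℕₚ.+-monoʳ-< s (lt b)

  row-f⁻ : ∀ {e e′} → RowRel (f e) (f e′) → RowRel e e′
  row-f⁻ {e} {e′} (le , lt) rewrite f-value e | f-value e′ | f-overlined e =
    ℕₚ.+-cancelˡ-≤ s _ _ le , λ b → ℕₚ.+-cancelˡ-< s _ _ (lt b)

  col-f : ∀ {e e′} → ColRel e e′ → ColRel (f e) (f e′)
  col-f {e} {e′} (le , eq) rewrite f-value e | f-value e′ | f-overlined e′ =
    ℕₚ.+-monoʳ-≤ s le , λ p → eq (ℕₚ.+-cancelˡ-≡ s _ _ p)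

  col-f⁻ : ∀ {e e′} → ColRel (f e) (f e′) → ColRel e e′
  col-f⁻ {e} {e′} (le , eq) rewrite f-value e | f-value e′ | f-overlined e′ =
    ℕₚ.+-cancelˡ-≤ s _ _ le , λ p → eq (cong (s ℕ.+_) p)

  join : List Entry → ℕ → List Entry
  join r d = map f r ++ replicate d x₀

  length-join : ∀ r d → length (join r d) ≡ length r ℕ.+ d
  length-join r d = trans (length-++ (map f r)) (cong₂ ℕ._+_ (length-map f r) (length-replicate d))

  unjoin : List Entry → List Entry
  unjoin []      = []
  unjoin (e ∷ r) = maybe′ (_∷ unjoin r) [] (g e)

  unjoin-join : ∀ {r} d → All A′ r → unjoin (join r d) ≡ r
  unjoin-join zero    []      = refl
  unjoin-join (suc d) []      = cong (maybe′ _ []) g-x₀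
  unjoin-join d       (a ∷ p) = trans (cong (maybe′ _ []) (g-f a)) (cong (_ ∷_) (unjoin-join d p))

  All-join : ∀ {r} d → All A′ r → All A (join r d)
  All-join zero    []      = []
  All-join (suc d) []      = A-x₀ ∷ All-join d []
  All-join d       (a ∷ p) = A-f a ∷ All-join d p

  Linked-join : ∀ {r} d → RowBound κ d → All A′ r → Linked RowRel r → Linked RowRel (join r d)
  Linked-join d b []           []      = repeated d b
    where
    repeated : ∀ d → RowBound κ d → Linked RowRel (replicate d x₀)
    repeated zero          _ = []
    repeated (suc zero)    _ = [-]
    repeated (suc (suc d)) b = let eq , b′ = RowBound-2 κ {d} b in row-x₀ eq ∷ repeated (suc d) b′
  Linked-join zero    b (a ∷ [])    [-]     = [-]
  Linked-join (suc d) b (a ∷ [])    [-]     = row-f-x₀ a ∷ Linked-join (suc d) b [] []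
  Linked-join d       b (a ∷ p)     (r ∷ l) = row-f r ∷ Linked-join d b p l

  Decomposition : List Entry → Set
  Decomposition row = Σ (List Entry) λ r → Σ ℕ λ d →
    row ≡ join r d × All A′ r × Linked RowRel r × RowBound κ d

  -- By `row-x₀-f` no image under `f` can follow `x₀`, so the copies of `x₀` form the end of the
  -- row; two adjacent copies force the horizontal kind.
  decompose : ∀ {row} → All A row → Linked RowRel row → Decomposition row
  decompose []      [] = [] , 0 , refl , [] , [] , RowBound-1 κ z≤n
  decompose (a ∷ []) [-] with view a
  ... | inj₁ refl            = [] , 1 , refl , [] , [] , RowBound-1 κ ℕₚ.≤-refl
  ... | inj₂ (e′ , a′ , refl) = (e′ ∷ []) , 0 , refl , a′ ∷ [] , [-] , RowBound-1 κ z≤n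
  decompose (a ∷ p@(_ ∷ _)) (rel ∷ l) with view a | decompose p l
  ... | inj₁ refl             | []     , suc d , refl , _      , _  , _ = [] , suc (suc d) , refl , [] , [] , RowBound-horiz (row-x₀⁻ rel)
  ... | inj₁ refl             | e ∷ r , d     , refl , a′ ∷ _ , _  , _ = ⊥-elim (row-x₀-f a′ rel)
  ... | inj₂ (e′ , a′ , refl) | []     , suc d , refl , _      , _  , b = (e′ ∷ []) , suc d , refl , a′ ∷ [] , [-] , b
  ... | inj₂ (e′ , a′ , refl) | e ∷ r , d     , refl , p′     , l′ , b = (e′ ∷ e ∷ r) , d , refl , a′ ∷ p′ , row-f⁻ rel ∷ l′ , b

  -- A copy of `x₀` may always stand below an image under `f`. Below another `x₀` it requires the
  -- vertical kind, and below no cell at all it is excluded; `ColBound` decides both cases.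
  Above-join : ∀ {r₁ r₂} d₁ d₂ → All A′ r₁ → Above r₁ r₂ →
    ColBound κ (length r₂ ℕ.+ d₂) (length r₁ ℕ.+ d₁) (length r₁) → Above (join r₁ d₁) (join r₂ d₂)
  Above-join d₁ d₂ (_ ∷ p) (c ∷ ab) b = col-f c ∷ Above-join d₁ d₂ p ab (ColBound-pred κ b)
  Above-join d₁ zero     p       []  b = []
  Above-join {[]} zero (suc d₂) [] [] b = ⊥-elim (ColBound-00 κ b)
  Above-join {[]} (suc d₁) (suc d₂) [] [] b = let eq , b′ = ColBound-vert κ b in col-x₀ eq ∷ Above-join d₁ d₂ [] [] b′
  Above-join d₁ (suc d₂) (a ∷ p) []  b = col-f-x₀ a ∷ Above-join d₁ d₂ p [] (ColBound-pred κ b)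

  Above-join⁻ : ∀ r₁ r₂ d₁ d₂ → All A′ r₂ → Above (join r₁ d₁) (join r₂ d₂) →
    Above r₁ r₂ × ColBound κ (length r₂ ℕ.+ d₂) (length r₁ ℕ.+ d₁) (length r₁)
  Above-join⁻ [] [] d₁ d₂ _ ab = [] , repeated d₁ d₂ ab
    where
    repeated : ∀ d₁ d₂ → Above (replicate d₁ x₀) (replicate d₂ x₀) → ColBound κ d₂ d₁ 0
    repeated d₁       zero     ab       = ColBound-0 κ
    repeated (suc d₁) (suc d₂) (c ∷ ab) = ColBound-vert⁻ (col-x₀⁻ c) (repeated d₁ d₂ ab)
  Above-join⁻ [] (_ ∷ _) (suc d₁) d₂ (a ∷ _) (c ∷ _) = ⊥-elim (col-x₀-f a c)
  Above-join⁻ (_ ∷ r₁) [] d₁ zero     _ ab = [] , ColBound-0 κ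
  Above-join⁻ (_ ∷ r₁) [] d₁ (suc d₂) p (_ ∷ ab) =
    let _ , b = Above-join⁻ r₁ [] d₁ d₂ p ab in [] , ColBound-suc κ b
  Above-join⁻ (_ ∷ r₁) (_ ∷ r₂) d₁ d₂ (_ ∷ p) (c ∷ ab) =
    let ab′ , b = Above-join⁻ r₁ r₂ d₁ d₂ p ab in col-f⁻ c ∷ ab′ , ColBound-suc κ b

  fill : List ℕ → Filling → Filling
  fill (x ∷ xs) (r ∷ F) = join r (x ∸ length r) ∷ fill xs F
  fill _        _       = []

  unfill : Filling → Filling
  unfill = map unjoin

  fill-valid : ∀ xs F → Part xs → Strip κ xs (shapeOf F) → Valid A′ F →
    Valid A (fill xs F) × shapeOf (fill xs F) ≡ xs × unfill (fill xs F) ≡ F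
  fill-valid [] [] _ _ _ = tt , refl , refl
  fill-valid [] (_ ∷ _) _ st _ = ⊥-elim (strip-[]ˡ κ st)
  fill-valid (_ ∷ _) [] _ st _ = ⊥-elim (strip-[]ʳ κ st)
  fill-valid (x ∷ xs) (r ∷ F) (h , pt) st (all , linked , above , valid)
    with strip-elim κ h st
  ... | y≤x , rb , cb , st′ with fill-valid xs F pt st′ valid
  ... | valid′ , shape , inv =
    (All-join _ all , Linked-join _ rb all linked , abv xs F shape st′ above cb , valid′) ,
    cong₂ _∷_ (trans (length-join r _) (ℕₚ.m+[n∸m]≡n y≤x)) shape ,
    cong₂ _∷_ (unjoin-join _ all) inv
    where
    abv : ∀ xs F → shapeOf (fill xs F) ≡ xs → Strip κ xs (shapeOf F) → Above r (firstRow F) →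
      ColBound κ (head₀ xs) x (length r) → Above (join r (x ∸ length r)) (firstRow (fill xs F))
    abv []       F        _     _ _  _  = []
    abv (_ ∷ _)  []       _     _ _  _  = []
    abv (x₂ ∷ _) (r₂ ∷ _) shape st ab cb = Above-join (x ∸ length r) (x₂ ∸ length r₂) all ab
      (subst₂ (λ u v → ColBound κ u v (length r))
        (trans (sym (cong head₀ shape)) (length-join r₂ _))
        (sym (ℕₚ.m+[n∸m]≡n y≤x)) cb)

  unfill-valid : ∀ F → Valid A F →
    Strip κ (shapeOf F) (shapeOf (unfill F)) × Valid A′ (unfill F) × fill (shapeOf F) (unfill F) ≡ F
  unfill-valid [] _ = strip-[] κ , tt , refl
  unfill-valid (row ∷ F) (all , linked , above , valid)
    with decompose all linked | unfill-valid F valid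
  ... | r , d , refl , all′ , linked′ , rb | st , valid′ , inv
    rewrite unjoin-join d all′ | length-join r d =
    strip-intro κ (length r) d rb (subst (_≤ length r) (sym (head₀-shapeOf (unfill F))) (Above-length (proj₁ (next F above valid))))
      (subst (λ x₂ → ColBound κ x₂ (length r ℕ.+ d) (length r)) (sym (head₀-shapeOf F)) (proj₂ (next F above valid))) st ,
    (all′ , linked′ , proj₁ (next F above valid) , valid′) ,
    cong₂ _∷_ (cong (join r) (ℕₚ.m+n∸m≡n (length r) d)) inv
    where
    next : ∀ F → Above (join r d) (firstRow F) → Valid A F →
      Above r (firstRow (unfill F)) × ColBound κ (length (firstRow F)) (length r ℕ.+ d) (length r)
    next []         _  _ = [] , ColBound-0 κ
    next (row₂ ∷ _) ab (all₂ , linked₂ , _) with decompose all₂ linked₂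
    ... | r₂ , d₂ , refl , all₂′ , _ rewrite unjoin-join d₂ all₂′ | length-join r₂ d₂ =
      Above-join⁻ r r₂ d d₂ all₂′ ab

  -- Images under `f` gain `s` and `x₀` itself has value `s`, so every cell of the outer row
  -- contributes `s`, inside the strip or not.
  sum-join : ∀ r d → sum (map proj₁ (join r d)) ≡ sum (map proj₁ r) ℕ.+ (length r ℕ.+ d) ℕ.* s
  sum-join []      zero    = refl
  sum-join []      (suc d) = cong₂ ℕ._+_ x₀-value (sum-join [] d)
  sum-join (e ∷ r) d       = trans (cong₂ ℕ._+_ (f-value e) (sum-join r d))
    (NS.solve 4 (λ s v t n → (s NS.:+ v) NS.:+ (t NS.:+ n) NS.:= v NS.:+ t NS.:+ (s NS.:+ n)) refl s (proj₁ e) (sum (map proj₁ r)) _)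
    where
    module NS = +-*-Solver

  overlined-∷ : ∀ e r → overlined (e ∷ r) ≡ ind (proj₂ e) ℕ.+ overlined r
  overlined-∷ (_ , true)  r = refl
  overlined-∷ (_ , false) r = refl

  overlined-join : ∀ r d → overlined (join r d) ≡ overlined r ℕ.+ d ℕ.* ind (proj₂ x₀)
  overlined-join []      zero    = refl
  overlined-join []      (suc d) = trans (overlined-∷ x₀ _) (cong (ind (proj₂ x₀) ℕ.+_) (overlined-join [] d))
  overlined-join (e ∷ r) d       = trans (overlined-∷ (f e) _) (trans
    (cong₂ (λ b n → ind b ℕ.+ n) (f-overlined e) (overlined-join r d))
    (trans (sym (ℕₚ.+-assoc (ind (proj₂ e)) _ _)) (cong (ℕ._+ _) (sym (overlined-∷ e r)))))

  size-fill : ∀ xs F → Part xs → Strip κ xs (shapeOf F) → size (fill xs F) ≡ size F ℕ.+ sum xs ℕ.* s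
  size-fill [] [] _ _ = refl
  size-fill [] (_ ∷ _) _ st = ⊥-elim (strip-[]ˡ κ st)
  size-fill (_ ∷ _) [] _ st = ⊥-elim (strip-[]ʳ κ st)
  size-fill (x ∷ xs) (r ∷ F) (h , pt) st =
    let y≤x , _ , _ , st′ = strip-elim κ h st in
    trans (cong₂ ℕ._+_ (trans (sum-join r (x ∸ length r)) (cong (λ n → sum (map proj₁ r) ℕ.+ n ℕ.* s) (ℕₚ.m+[n∸m]≡n y≤x))) (size-fill xs F pt st′))
      (NS.solve 5 (λ a x b y s → a NS.:+ x NS.:* s NS.:+ (b NS.:+ y NS.:* s) NS.:= a NS.:+ b NS.:+ (x NS.:+ y) NS.:* s)
        refl (sum (map proj₁ r)) x (size F) (sum xs) s)
    where
    module NS = +-*-Solver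

  overlines-fill : ∀ xs F → Part xs → Strip κ xs (shapeOf F) →
    overlines (fill xs F) ≡ overlines F ℕ.+ defect xs (shapeOf F) ℕ.* ind (proj₂ x₀)
  overlines-fill [] [] _ _ = refl
  overlines-fill [] (_ ∷ _) _ st = ⊥-elim (strip-[]ˡ κ st)
  overlines-fill (_ ∷ _) [] _ st = ⊥-elim (strip-[]ʳ κ st)
  overlines-fill (x ∷ xs) (r ∷ F) (h , pt) st =
    let y≤x , _ , _ , st′ = strip-elim κ h st in
    trans (cong₂ ℕ._+_ (overlined-join r (x ∸ length r)) (overlines-fill xs F pt st′))
      (NS.solve 5 (λ a x b y s → a NS.:+ x NS.:* s NS.:+ (b NS.:+ y NS.:* s) NS.:= a NS.:+ b NS.:+ (x NS.:+ y) NS.:* s)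
        refl (overlined r) (x ∸ length r) (overlines F) (defect xs (shapeOf F)) (ind (proj₂ x₀)))
    where
    module NS = +-*-Solver

  -- Additive equations, in contrast to truncated differences, have no solution when n or k is too
  -- small, in agreement with the vanishing coefficient.
  Residue : List ℕ → ℕ → ℕ → List ℕ → Filling → Set
  Residue xs n k ys F = Valid A′ F × shapeOf F ≡ ys ×
    size F ℕ.+ sum xs ℕ.* s ≡ n × overlines F ℕ.+ defect xs ys ℕ.* ind (proj₂ x₀) ≡ k

  enum-Filled : ∀ xs → Part xs → ∀ S → Unique S →
    (∀ {ys} → ys ∈ S → Strip κ xs ys) → (∀ {ys} → Strip κ xs ys → ys ∈ S) → ∀ φ n k →
    (∀ {ys} → ys ∈ S → Enum (Residue xs n k ys) (φ ys n k)) →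
    Enum (Filled A xs n k) ((Σ[ S ] φ) n k)
  enum-Filled xs pt S u S⁻ S⁺ φ n k e = enum-map (fill xs) unfill to from
    (enum-Σ S (Residue xs n k) φ n k (λ (_ , p , _) (_ , q , _) → trans (sym p) q) u e)
    where
    to : ∀ F → (Σ (List ℕ) λ ys → ys ∈ S × Residue xs n k ys F) → Filled A xs n k (fill xs F) × unfill (fill xs F) ≡ F
    to F (_ , ys∈ , valid , refl , sz , ov) =
      let st = S⁻ ys∈
          valid′ , shape , inv = fill-valid xs F pt st valid
      in (valid′ , shape , trans (size-fill xs F pt st) sz , trans (overlines-fill xs F pt st) ov) , inv
    from : ∀ F → Filled A xs n k F → (Σ (List ℕ) λ ys → ys ∈ S × Residue xs n k ys (unfill F)) × fill xs (unfill F) ≡ F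
    from F (valid , refl , sz , ov) =
      let st , valid′ , inv = unfill-valid F valid
      in (shapeOf (unfill F) , S⁺ st , valid′ , refl ,
          trans (sym (size-fill _ (unfill F) pt st)) (trans (cong size inv) sz) ,
          trans (sym (overlines-fill _ (unfill F) pt st)) (trans (cong overlines inv) ov)) , inv

-- Unbarred₀ describes the entries that are left when the entries 1̄ are removed
-- and all values are lowered by one.
Positive Unbarred₀ : Entry → Set
Positive  (v , b) = 1 ≤ v
Unbarred₀ (v , b) = v ≡ 0 → b ≡ false

unOne unZero : Entry → Maybe Entry
unOne (zero , b)           = nothing
unOne (suc zero , true)    = nothing
unOne (suc zero , false)   = just (zero , false)
unOne (suc (suc v) , b)    = just (suc v , b)
unZero (zero , b)  = nothing
unZero (suc v , b) = just (suc v , b)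

true≢false : ¬ true ≡ false
true≢false ()

-- In a row, whatever follows 1̄ must be smaller, while in a column 1̄ may follow 1̄: hence the
-- vertical kind.
ones : Layer
ones = record
  { κ = vert ; A = Positive ; A′ = Unbarred₀ ; s = 1 ; x₀ = 1 , true
  ; f = λ (v , b) → suc v , b
  ; g = unOne
  ; f-value = λ _ → refl
  ; f-overlined = λ _ → refl
  ; x₀-value = refl
  ; A-f = λ _ → s≤s z≤n
  ; A-x₀ = s≤s z≤n
  ; g-f = λ { {zero , true}  a → ⊥-elim (true≢false (a refl))
            ; {zero , false} _ → refl
            ; {suc v , b}    _ → refl }
  ; g-x₀ = refl
  ; view = λ { {suc zero , true}  _ → inj₁ refl
             ; {suc zero , false} _ → inj₂ ((0 , false) , (λ _ → refl) , refl)
             ; {suc (suc v) , b}  _ → inj₂ ((suc v , b) , (λ ()) , refl) }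
  ; row-f-x₀ = λ { {zero , b}  a → s≤s z≤n , λ b≡true → ⊥-elim (true≢false (trans (sym b≡true) (a refl)))
                 ; {suc v , b} _ → s≤s z≤n , λ _ → s≤s (s≤s z≤n) }
  ; row-x₀-f = λ _ (_ , lt) → ℕₚ.<⇒≱ (lt refl) (s≤s z≤n)
  ; col-f-x₀ = λ _ → s≤s z≤n , λ _ → refl
  ; col-x₀-f = λ { {zero , b}  a (_ , eq) → true≢false (trans (sym (eq refl)) (a refl))
                 ; {suc v , b} _ (s≤s () , _) }
  ; row-x₀ = λ ()
  ; row-x₀⁻ = λ (_ , lt) → ⊥-elim (ℕₚ.<-irrefl refl (lt refl))
  ; col-x₀ = λ _ → ℕₚ.≤-refl , λ _ → refl
  ; col-x₀⁻ = λ _ → refl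
  }

-- An unbarred 0 may repeat in a row, but a repetition in a column would need an overline: hence the
-- horizontal kind. The other entries are already positive, so nothing is lowered and `s` is 0.
zeros : Layer
zeros = record
  { κ = horiz ; A = Unbarred₀ ; A′ = Positive ; s = 0 ; x₀ = 0 , false
  ; f = λ e → e
  ; g = unZero
  ; f-value = λ _ → refl
  ; f-overlined = λ _ → refl
  ; x₀-value = refl
  ; A-f = λ { {suc v , b} _ () }
  ; A-x₀ = λ _ → refl
  ; g-f = λ { {suc v , b} _ → refl }
  ; g-x₀ = refl
  ; view = λ { {zero , true}  a → ⊥-elim (true≢false (a refl))
             ; {zero , false} _ → inj₁ refl
             ; {suc v , b}    _ → inj₂ ((suc v , b) , s≤s z≤n , refl) }
  ; row-f-x₀ = λ a → z≤n , λ _ → a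
  ; row-x₀-f = λ a (le , _) → ℕₚ.<⇒≱ a le
  ; col-f-x₀ = λ a → z≤n , λ { refl → ⊥-elim (ℕₚ.<-irrefl refl a) }
  ; col-x₀-f = λ a (le , _) → ℕₚ.<⇒≱ a le
  ; row-x₀ = λ _ → z≤n , λ ()
  ; row-x₀⁻ = λ _ → refl
  ; col-x₀ = λ ()
  ; col-x₀⁻ = λ (_ , eq) → ⊥-elim (true≢false (sym (eq refl)))
  }

module PeelOnes  = Peel ones
module PeelZeros = Peel zeros

-- The recursion for the numbers of fillings

⟦geom⟧ : ℕ → Rq.Carrier
⟦geom⟧ h = ⟦ geom h ⟧

module HC = Evaluation.HookContent Rq q̂ â ⟦geom⟧ ⟦geom⟧-unfold Q.var-cancel

coefficient-≤ : ∀ s d f {n k} → s ≤ n → d ≤ k →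
  ((q̂ ^q s) Rq.* ((â ^q d) Rq.* f)) n k ≡ f (n ∸ s) (k ∸ d)
coefficient-≤ s d f {n} {k} s≤n d≤k = trans (Q.var^-*-≤ s ((â ^q d) Rq.* f) s≤n k)
  (trans (Q.const^-* A.var d f (n ∸ s) k) (A.var^-*-≤ d (f (n ∸ s)) d≤k))

coefficient-<ˡ : ∀ s d f {n k} → n < s → ((q̂ ^q s) Rq.* ((â ^q d) Rq.* f)) n k ≡ + 0
coefficient-<ˡ s d f {n} {k} n<s = Q.var^-*-< s ((â ^q d) Rq.* f) n<s k

coefficient-<ʳ : ∀ s d f {n k} → s ≤ n → k < d → ((q̂ ^q s) Rq.* ((â ^q d) Rq.* f)) n k ≡ + 0
coefficient-<ʳ s d f {n} {k} s≤n k<d = trans (Q.var^-*-≤ s ((â ^q d) Rq.* f) s≤n k)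
  (trans (Q.const^-* A.var d f (n ∸ s) k) (A.var^-*-< d (f (n ∸ s)) k<d))

-- Fixing only n leaves the shape and the number of overlines free to change during the induction on
-- the size.
EnumAt : (Entry → Set) → Rq.Carrier → ℕ → Set
EnumAt A u n = ∀ xs → Part xs → ∀ k → Enum (Filled A xs n k) (HC.JT u xs n k)

-- Removing zeros changes neither the size nor the number of overlines, so n stays the same; the
-- descent comes from the layer of ones.
enum-Unbarred₀ : ∀ n → EnumAt Positive (q̂ Rq.* Rq.1#) n → EnumAt Unbarred₀ Rq.1# n
enum-Unbarred₀ n e xs pt k = subst (Enum _) (sym (HC.JT-horizontal xs pt n k))
  (PeelZeros.enum-Filled xs pt (hStrips xs)
    (strips-unique hChoices (λ x xs ys → interval-unique (head₀ xs) (x ∸ head₀ xs)) xs)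
    (∈-hStrips⁻ xs pt) ∈-hStrips⁺ (HC.JT (q̂ Rq.* Rq.1#)) n k
    (λ {ys} ys∈ → enum-iff
      (λ F (valid , shape , sz , ov) → valid , shape , trans (+*0 (size F) (sum xs)) sz , trans (+*0 (overlines F) (defect xs ys)) ov)
      (λ F (valid , shape , sz , ov) → valid , shape , trans (sym (+*0 (size F) (sum xs))) sz , trans (sym (+*0 (overlines F) (defect xs ys))) ov)
      (e ys (HStrip-Part (∈-hStrips⁻ xs pt ys∈)) k)))
  where
  +*0 : ∀ m n → m ℕ.+ n ℕ.* 0 ≡ m
  +*0 m n = trans (cong (m ℕ.+_) (ℕₚ.*-zeroʳ n)) (ℕₚ.+-identityʳ m)

enum-Residue : ∀ xs n k ys → EnumAt Unbarred₀ Rq.1# (n ∸ sum xs) → Part ys →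
  Enum (PeelOnes.Residue xs n k ys) (((q̂ ^q sum xs) Rq.* ((â ^q defect xs ys) Rq.* HC.JT Rq.1# ys)) n k)
enum-Residue xs n k ys e pt with sum xs ≤? n | defect xs ys ≤? k
... | no s≰n | _ = subst (Enum _) (sym (coefficient-<ˡ (sum xs) (defect xs ys) (HC.JT Rq.1# ys) (ℕₚ.≰⇒> s≰n)))
  (enum-empty (λ { F (_ , _ , refl , _) → s≰n (ℕₚ.≤-trans (ℕₚ.≤-reflexive (sym (ℕₚ.*-identityʳ (sum xs)))) (ℕₚ.m≤n+m _ (size F))) }))
... | yes s≤n | no d≰k = subst (Enum _) (sym (coefficient-<ʳ (sum xs) (defect xs ys) (HC.JT Rq.1# ys) s≤n (ℕₚ.≰⇒> d≰k)))
  (enum-empty (λ { F (_ , _ , _ , refl) → d≰k (ℕₚ.≤-trans (ℕₚ.≤-reflexive (sym (ℕₚ.*-identityʳ (defect xs ys)))) (ℕₚ.m≤n+m _ (overlines F))) }))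
... | yes s≤n | yes d≤k = subst (Enum _) (sym (coefficient-≤ (sum xs) (defect xs ys) (HC.JT Rq.1# ys) s≤n d≤k))
  (enum-iff
    (λ F (valid , shape , sz , ov) → valid , shape , shift⁺ (sum xs) s≤n sz , shift⁺ (defect xs ys) d≤k ov)
    (λ F (valid , shape , sz , ov) → valid , shape , shift⁻ (sum xs) sz , shift⁻ (defect xs ys) ov)
    (e ys pt (k ∸ defect xs ys)))
  where
  shift⁺ : ∀ s {m n} → s ≤ n → m ≡ n ∸ s → m ℕ.+ s ℕ.* 1 ≡ n
  shift⁺ s s≤n refl = trans (cong (_ ∸ s ℕ.+_) (ℕₚ.*-identityʳ s)) (ℕₚ.m∸n+n≡m s≤n)
  shift⁻ : ∀ s {m n} → m ℕ.+ s ℕ.* 1 ≡ n → m ≡ n ∸ s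
  shift⁻ s {m} refl = trans (sym (ℕₚ.m+n∸n≡m m s)) (cong (λ t → m ℕ.+ t ∸ s) (sym (ℕₚ.*-identityʳ s)))

emptyRows : List ℕ → Filling
emptyRows = map (λ _ → [])

-- A shape without cells allows no descent in n and is counted directly.
enum-zeros : ∀ A xs → sum xs ≡ 0 → ∀ n k → Enum (Filled A xs n k) (Rq.1# n k)
enum-zeros A xs s≡0 n k = go n k
  where
  valid : ∀ xs → Valid A (emptyRows xs)
  valid []           = tt
  valid (_ ∷ [])     = [] , [] , [] , tt
  valid (_ ∷ x ∷ xs) = [] , [] , [] , valid (x ∷ xs)
  shape : ∀ xs → sum xs ≡ 0 → shapeOf (emptyRows xs) ≡ xs
  shape []          _  = refl
  shape (zero ∷ xs) eq = cong (0 ∷_) (shape xs eq)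
  size-0 : ∀ xs → size (emptyRows xs) ≡ 0
  size-0 []       = refl
  size-0 (_ ∷ xs) = size-0 xs
  overlines-0 : ∀ xs → overlines (emptyRows xs) ≡ 0
  overlines-0 []       = refl
  overlines-0 (_ ∷ xs) = overlines-0 xs
  only : ∀ F xs → sum xs ≡ 0 → shapeOf F ≡ xs → F ≡ emptyRows xs
  only []       _ _  refl = refl
  only ([] ∷ F) _ eq refl = cong ([] ∷_) (only F _ eq refl)
  go : ∀ n k → Enum (Filled A xs n k) (Rq.1# n k)
  go zero zero = emptyRows xs ∷ [] , [] ∷ [] ,
    (λ F → (λ { (here refl) → valid xs , shape xs s≡0 , size-0 xs , overlines-0 xs })
         , λ (_ , sh , _) → here (only F xs s≡0 sh)) , refl
  go zero (suc k) = enum-empty (λ F (_ , sh , _ , ov) →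
    ℕₚ.0≢1+n (trans (sym (overlines-0 xs)) (trans (cong overlines (sym (only F xs s≡0 sh))) ov)))
  go (suc n) k = enum-empty (λ F (_ , sh , sz , _) →
    ℕₚ.0≢1+n (trans (sym (size-0 xs)) (trans (cong size (sym (only F xs s≡0 sh))) sz)))

JT-vertical′ : ∀ xs → Part xs → HC.JT (q̂ Rq.* Rq.1#) xs Rq.≈
  Σ[ vStrips xs ] (λ ys → (q̂ ^q sum xs) Rq.* ((â ^q defect xs ys) Rq.* HC.JT Rq.1# ys))
JT-vertical′ xs pt n k = trans (HC.JT-vertical xs pt n k)
  (sym (Σ-*ˡ (vStrips xs) (q̂ ^q sum xs) (λ ys → (â ^q defect xs ys) Rq.* HC.JT Rq.1# ys) n k))

enum-Positive : ∀ n → EnumAt Positive (q̂ Rq.* Rq.1#) n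
enum-Positive = <-rec (EnumAt Positive (q̂ Rq.* Rq.1#)) step
  where
  step : ∀ n → (∀ {m} → m < n → EnumAt Positive (q̂ Rq.* Rq.1#) m) → EnumAt Positive (q̂ Rq.* Rq.1#) n
  step n rec xs pt k with sum xs ≟ 0
  ... | yes s≡0 = subst (Enum _) (sym (HC.JT-zeros (q̂ Rq.* Rq.1#) xs pt s≡0 n k)) (enum-zeros Positive xs s≡0 n k)
  ... | no  s≢0 = subst (Enum _) (sym (JT-vertical′ xs pt n k))
    (PeelOnes.enum-Filled xs pt (vStrips xs) (strips-unique vChoices vChoices-unique xs)
      (∈-vStrips⁻ xs pt) ∈-vStrips⁺ _ n k
      (λ {ys} ys∈ → residue ys (VStrip-Part (∈-vStrips⁻ xs pt ys∈))))
    where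
    residue : ∀ ys → Part ys →
      Enum (PeelOnes.Residue xs n k ys) (((q̂ ^q sum xs) Rq.* ((â ^q defect xs ys) Rq.* HC.JT Rq.1# ys)) n k)
    residue ys pt with n ≟ 0
    ... | no  n≢0  = enum-Residue xs n k ys (enum-Unbarred₀ (n ∸ sum xs) (rec (smaller n (sum xs) n≢0 s≢0))) pt
      where
      smaller : ∀ n s → ¬ n ≡ 0 → ¬ s ≡ 0 → n ∸ s < n
      smaller zero    s       n≢0 _   = ⊥-elim (n≢0 refl)
      smaller (suc n) zero    _   s≢0 = ⊥-elim (s≢0 refl)
      smaller (suc n) (suc s) _   _   = s≤s (ℕₚ.m∸n≤m n s)
    ... | yes refl = subst (Enum _)
      (sym (coefficient-<ˡ (sum xs) (defect xs ys) (HC.JT Rq.1# ys) {0} {k} (ℕₚ.n≢0⇒n>0 s≢0)))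
      (enum-empty (λ F (_ , _ , sz , _) → s≢0 (trans (sym (ℕₚ.*-identityʳ (sum xs))) (ℕₚ.m+n≡0⇒n≡0 (size F) sz))))

-- The product over cells as an iterated row evaluation

Linked⇒Part : ∀ {xs} → Linked _≥_ xs → Part xs
Linked⇒Part []      = tt
Linked⇒Part [-]     = z≤n , tt
Linked⇒Part (h ∷ l) = h , Linked⇒Part l

row-++ : ∀ pre x xs → row (pre ++ x ∷ xs) (suc (length pre)) ≡ x
row-++ []        x xs = refl
row-++ (_ ∷ pre) x xs = row-++ pre x xs

conj-++ : ∀ pre x xs {j} → All (j ≤_) pre → j ≤ x → conj (pre ++ x ∷ xs) j ≡ length pre ℕ.+ suc (conj xs j)
conj-++ []        x xs []       j≤x = conj-accept x xs j≤x
conj-++ (y ∷ pre) x xs (j≤y ∷ p) j≤x = trans (conj-accept y (pre ++ x ∷ xs) j≤y) (cong suc (conj-++ pre x xs p j≤x))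

-- The rows in `pre` all reach column j, so they lengthen the column by exactly the amount that the
-- row number subtracts. What remains is arm, leg and one.
hook-++ : ∀ pre x xs {j} → All (x ≤_) pre → j ≤ x →
          hook (pre ++ x ∷ xs) (suc (length pre)) j ≡ suc (x ∸ j ℕ.+ conj xs j)
hook-++ pre x xs {j} x≤ j≤x
  rewrite row-++ pre x xs | conj-++ pre x xs (All.map (ℕₚ.≤-trans j≤x) x≤) j≤x =
  trans (cong (_∸ (suc (length pre) ℕ.+ j)) (trans
    (cong (λ t → t ℕ.+ (length pre ℕ.+ suc (conj xs j)) ℕ.+ 1) (sym (ℕₚ.m+[n∸m]≡n j≤x)))
    (solve 4 (λ j d p c → j :+ d :+ (p :+ (con 1 :+ c)) :+ con 1 := (con 1 :+ p :+ j) :+ (con 1 :+ (d :+ c)))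
      refl j (x ∸ j) (length pre) (conj xs j))))
    (ℕₚ.m+n∸m≡n (suc (length pre) ℕ.+ j) _)
  where
  open +-*-Solver

cellFactor : List ℕ → ℕ × ℕ → Rq.Carrier
cellFactor sh (i , j) = ((q̂ ^q i) Rq.+ (â Rq.* (q̂ ^q j))) Rq.* ⟦ geom (hook sh i j) ⟧

-- Hooks refer to the whole shape while the cells are listed row by row, so the rows already passed
-- are carried along as `pre`. Advancing by one row turns q^i into q^(i + 1), which is the change of
-- u in `JT-row`.
Π-cells : ∀ sh pre xs → sh ≡ pre ++ xs → All (head₀ xs ≤_) pre → Part xs →
  Π[ cellsFrom (suc (length pre)) xs ] (cellFactor sh) Rq.≈ HC.JT (q̂ ^q suc (length pre)) xs
Π-cells sh pre []       _    _  _           = Rq.refl {Rq.1#}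
Π-cells _  pre (x ∷ xs) refl x≤ pt@(h , pt′) = begin
  Π[ map (i ,_) (map suc (upTo x)) ++ cellsFrom (suc i) xs ] F
    ≈⟨ Π-++ (map (i ,_) (map suc (upTo x))) (cellsFrom (suc i) xs) F ⟩
  Π[ map (i ,_) (map suc (upTo x)) ] F Rq.* Π[ cellsFrom (suc i) xs ] F
    ≈⟨ Rq.*-cong {Π[ map (i ,_) (map suc (upTo x)) ] F} {Π₁ rowFactor x} {Π[ cellsFrom (suc i) xs ] F} {HC.JT (q̂ ^q suc i) xs} firstRow≈ rest ⟩
  Π₁ rowFactor x Rq.* HC.JT (q̂ ^q suc i) xs
    ≈⟨ HC.JT-row (q̂ ^q i) x xs pt ⟨
  HC.JT (q̂ ^q i) (x ∷ xs) ∎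
  where
  open import Relation.Binary.Reasoning.Setoid Rq.setoid
  i : ℕ
  i = suc (length pre)
  F : ℕ × ℕ → Rq.Carrier
  F = cellFactor (pre ++ x ∷ xs)
  rowFactor : ℕ → Rq.Carrier
  rowFactor j = ((q̂ ^q i) Rq.+ (â Rq.* (q̂ ^q j))) Rq.* ⟦ geom (suc (x ∸ j ℕ.+ conj xs j)) ⟧
  firstRow≈ : Π[ map (i ,_) (map suc (upTo x)) ] F Rq.≈ Π₁ rowFactor x
  firstRow≈ = begin
    Π[ map (i ,_) (map suc (upTo x)) ] F
      ≈⟨ Π-map (i ,_) (map suc (upTo x)) F ⟩
    Π[ map suc (upTo x) ] (λ j → F (i , j))
      ≈⟨ Π-upTo (λ j → F (i , j)) x ⟩
    Π₁ (λ j → F (i , j)) x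
      ≈⟨ Π₁-cong {λ j → F (i , j)} {rowFactor} x (λ j _ j≤x → Rq.reflexive
           (cong (λ h → ((q̂ ^q i) Rq.+ (â Rq.* (q̂ ^q j))) Rq.* ⟦ geom h ⟧) (hook-++ pre x xs x≤ j≤x))) ⟩
    Π₁ rowFactor x ∎
  rest : Π[ cellsFrom (suc i) xs ] F Rq.≈ HC.JT (q̂ ^q suc i) xs
  rest = subst (λ l → Π[ cellsFrom (suc l) xs ] F Rq.≈ HC.JT (q̂ ^q suc l) xs)
    (trans (length-++ pre) (ℕₚ.+-comm (length pre) 1))
    (Π-cells (pre ++ x ∷ xs) (pre ++ x ∷ []) xs (sym (++-assoc pre (x ∷ []) xs))
      (Allₚ.++⁺ (All.map (ℕₚ.≤-trans h) x≤) (h ∷ [])) pt′)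

⟦rhs⟧ : ∀ sh → Part sh → ⟦ rhs sh ⟧ Rq.≈ HC.JT (q̂ Rq.* Rq.1#) sh
⟦rhs⟧ sh pt = begin
  ⟦ rhs sh ⟧
    ≈⟨ ⟦⟧-prodS (map cell (cells sh)) ⟩
  Π[ map cell (cells sh) ] ⟦_⟧
    ≈⟨ Π-map cell (cells sh) ⟦_⟧ ⟩
  Π[ cells sh ] (λ c → ⟦ cell c ⟧)
    ≈⟨ Π-cong (cells sh) {λ c → ⟦ cell c ⟧} {cellFactor sh} factor ⟩
  Π[ cells sh ] (cellFactor sh)
    ≈⟨ Π-cells sh [] sh refl [] pt ⟩
  HC.JT (q̂ Rq.* Rq.1#) sh ∎
  where
  open import Relation.Binary.Reasoning.Setoid Rq.setoid
  cell : ℕ × ℕ → Series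
  cell c = binom (proj₁ c) (proj₂ c) *S geom (hook sh (proj₁ c) (proj₂ c))
  factor : ∀ c → ⟦ cell c ⟧ Rq.≈ cellFactor sh c
  factor (i , j) = Rq.trans {⟦ cell (i , j) ⟧} {⟦ binom i j ⟧ Rq.* ⟦ geom (hook sh i j) ⟧} {cellFactor sh (i , j)}
    (⟦⟧-* (binom i j) (geom (hook sh i j)))
    (Rq.*-congʳ {⟦ geom (hook sh i j) ⟧} {⟦ binom i j ⟧} {(q̂ ^q i) Rq.+ (â Rq.* (q̂ ^q j))} (⟦⟧-binom i j))

-- Conditions on positions versus conditions on rows

at-there : ∀ r F i j → at (r ∷ F) (suc i) j ≡ at F i j
at-there r F i j with nth F i
... | nothing = refl
... | just _  = refl

nth-All : ∀ {A : Entry → Set} {r} → All A r → ∀ j {e} → nth r j ≡ just e → A e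
nth-All (a ∷ _) zero    refl = a
nth-All (_ ∷ p) (suc j) eq   = nth-All p j eq

All-nth : ∀ {A : Entry → Set} r → (∀ j {e} → nth r j ≡ just e → A e) → All A r
All-nth []      _ = []
All-nth (e ∷ r) p = p 0 refl ∷ All-nth r (λ j → p (suc j))

nth-Linked : ∀ {r} → Linked RowRel r → ∀ j {e e′} → nth r j ≡ just e → nth r (suc j) ≡ just e′ → RowRel e e′
nth-Linked (rel ∷ _) zero    refl refl = rel
nth-Linked (_ ∷ l)   (suc j) eq   eq′  = nth-Linked l j eq eq′

Linked-nth : ∀ r → (∀ j {e e′} → nth r j ≡ just e → nth r (suc j) ≡ just e′ → RowRel e e′) → Linked RowRel r
Linked-nth []           _ = []
Linked-nth (_ ∷ [])     _ = [-]
Linked-nth (_ ∷ e ∷ r)  p = p 0 refl refl ∷ Linked-nth (e ∷ r) (λ j → p (suc j))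

nth-Above : ∀ {u l} → Above u l → ∀ j {e e′} → nth u j ≡ just e → nth l j ≡ just e′ → ColRel e e′
nth-Above (c ∷ _)  zero    refl refl = c
nth-Above (_ ∷ ab) (suc j) eq   eq′  = nth-Above ab j eq eq′

-- Conditions on positions say nothing about a cell without an upper neighbour; the inequality of
-- lengths excludes such cells and is supplied by the partition condition on the shape.
Above-nth : ∀ u l → length l ≤ length u →
  (∀ j {e e′} → nth u j ≡ just e → nth l j ≡ just e′ → ColRel e e′) → Above u l
Above-nth u       []      _        _ = []
Above-nth (_ ∷ u) (_ ∷ l) (s≤s le) p = p 0 refl refl ∷ Above-nth u l le (λ j → p (suc j))

at-first : ∀ F j → at F 0 j ≡ nth (firstRow F) j
at-first []      j = refl
at-first (_ ∷ _) j = refl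

at-Positive : ∀ F → Valid Positive F → ∀ i j {e} → at F i j ≡ just e → Positive e
at-Positive (r ∷ F) (p , _) zero    j eq = nth-All p j eq
at-Positive (r ∷ F) (_ , _ , _ , v) (suc i) j eq = at-Positive F v i j (trans (sym (at-there r F i j)) eq)

at-RowRel : ∀ {A} F → Valid A F → ∀ i j {e e′} → at F i j ≡ just e → at F i (suc j) ≡ just e′ → RowRel e e′
at-RowRel (r ∷ F) (_ , l , _) zero    j eq eq′ = nth-Linked l j eq eq′
at-RowRel (r ∷ F) (_ , _ , _ , v) (suc i) j eq eq′ =
  at-RowRel F v i j (trans (sym (at-there r F i j)) eq) (trans (sym (at-there r F i (suc j))) eq′)

at-ColRel : ∀ {A} F → Valid A F → ∀ i j {e e′} → at F i j ≡ just e → at F (suc i) j ≡ just e′ → ColRel e e′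
at-ColRel (r ∷ F) (_ , _ , ab , _) zero j eq eq′ =
  nth-Above ab j eq (trans (sym (at-first F j)) (trans (sym (at-there r F 0 j)) eq′))
at-ColRel (r ∷ F) (_ , _ , _ , v) (suc i) j eq eq′ =
  at-ColRel F v i j (trans (sym (at-there r F i j)) eq) (trans (sym (at-there r F (suc i) j)) eq′)

valid-at : ∀ F → Part (shapeOf F) →
  (∀ i j {e} → at F i j ≡ just e → Positive e) →
  (∀ i j {e e′} → at F i j ≡ just e → at F i (suc j) ≡ just e′ → RowRel e e′) →
  (∀ i j {e e′} → at F i j ≡ just e → at F (suc i) j ≡ just e′ → ColRel e e′) → Valid Positive F
valid-at []      _        _ _ _ = tt
valid-at (r ∷ F) (h , pt) p l c =
  All-nth r (p 0) , Linked-nth r (l 0) ,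
  Above-nth r (firstRow F) (subst (_≤ length r) (head₀-shapeOf F) h)
    (λ j eq eq′ → c 0 j eq (trans (at-there r F 0 j) (trans (at-first F j) eq′))) ,
  valid-at F pt
    (λ i j eq → p (suc i) j (trans (at-there r F i j) eq))
    (λ i j eq eq′ → l (suc i) j (trans (at-there r F i j) eq) (trans (at-there r F i (suc j)) eq′))
    (λ i j eq eq′ → c (suc i) j (trans (at-there r F i j) eq) (trans (at-there r F (suc i) j) eq′))

valid⇒planeOverpartition : ∀ {sh} F → Valid Positive F → shapeOf F ≡ sh → IsPlaneOverpartition sh F
valid⇒planeOverpartition F v sh = record
  { shape    = sh
  ; positive = λ i j _ _ → at-Positive F v i j
  ; rowCond  = λ i j _ _ _ _ → at-RowRel F v i j
  ; colCond  = λ i j _ _ _ _ → at-ColRel F v i j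
  }

planeOverpartition⇒valid : ∀ {sh} F → Part sh → IsPlaneOverpartition sh F → Valid Positive F
planeOverpartition⇒valid F pt P = valid-at F (subst Part (sym shape) pt)
  (λ i j → positive i j _ _) (λ i j → rowCond i j _ _ _ _) (λ i j → colCond i j _ _ _ _)
  where open IsPlaneOverpartition P

theorem3 : (sh : List ℕ) → IsPartition sh → (n k : ℕ) →
    Σ (List Filling) (λ L →
    Unique L ×
    (∀ F → (F ∈ L → IsPlaneOverpartition sh F × size F ≡ n × overlines F ≡ k) ×
    (IsPlaneOverpartition sh F × size F ≡ n × overlines F ≡ k → F ∈ L)) ×
    length L ≡ rhs sh n k)
theorem3 sh (decreasing , _) n k =
  let pt = Linked⇒Part decreasing
      L , unique , members , len = enum-Positive n sh pt k
  in L , unique ,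
     (λ F → (λ F∈ → let v , s , sz , ov = proj₁ (members F) F∈ in valid⇒planeOverpartition F v s , sz , ov)
          , (λ (P , sz , ov) → proj₂ (members F) (planeOverpartition⇒valid F pt P , IsPlaneOverpartition.shape P , sz , ov))) ,
     ℤₚ.+-injective (trans len (sym (⟦rhs⟧ sh pt n k)))
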